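{- For any integer $m\ge 3$, the labeled graph on $v_1,\dots,v_{m+2}$ obtained by adding the edge $v_2v_{m+1}$ to the cycle $v_1v_2\dotsm v_{m+2}v_1$ (a cycle of length $m$ and a cycle of length $4$ sharing exactly one edge) is $(e)$-positive.
   Context: Let $G$ be a finite simple graph with vertices labeled $v_1,\dots,v_d$. Its chromatic symmetric function in noncommuting variables is $Y_G=\sum_\kappa x_{\kappa(v_1)}x_{\kappa(v_2)}\dotsm x_{\kappa(v_d)}$, where $x_1,x_2,\dots$ are noncommuting variables and the sum is over all proper colorings $\kappa\colon V(G)\to\{1,2,3,\dots\}$. Let $\Pi_d$ be the set of set partitions of $[d]=\{1,\dots,d\}$. For $\pi\in\Pi_d$, let $e_\pi=\sum_{(i_1,\dots,i_d)}x_{i_1}\dotsm x_{i_d}$, where the sum is over all sequences $(i_1,\dots,i_d)$ of positive integers such that $i_j\ne i_k$ whenever $j\neq k$ lie in the same block of $\pi$. The $e_\pi$, $\pi\in\Pi_d$, are linearly independent over $\mathbb{Q}$ and $Y_G$ is uniquely a rational linear combination $Y_G=\sum_{\sigma\in\Pi_d}c_\sigma e_\sigma$. The type $\lambda(\pi)$ is the integer partition of $d$ formed by the block sizes of $\pi$, and $b_\pi$ is the size of the block of $\pi$ containing $d$. Write $\pi\equiv\sigma$ if $\lambda(\pi)=\lambda(\sigma)$ and $b_\pi=b_\sigma$; let $(\pi)$ be the equivalence class of $\pi$, and set $c_{(\pi)}=\sum_{\sigma\in(\pi)}c_\sigma$. The labeled graph $G$ is called $(e)$-positive if $c_{(\pi)}\ge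 0$ for every equivalence class $(\pi)\subseteq\Pi_d$. Here $d=m+2$. -}

module Defs where

open import Data.Bool.Base using (if_then_else_)
open import Data.Fin.Base using (Fin; zero; suc; fromℕ; inject₁; toℕ)
open import Data.Fin.Properties as Fin using (all?)
open import Data.List.Base using (List; []; _∷_; map; concatMap; filter; foldr; length; allFin)
import Data.List.Properties as List
import Data.List.Sort as Sort
open import Data.Nat.Base using (ℕ; zero; suc)
import Data.Nat.Properties as ℕ
open import Data.Product.Base using (∃; _×_; _,_; proj₁; proj₂)
open import Data.Rational.Base using (ℚ; 0ℚ; 1ℚ; _+_; _*_; _≤_)
open import Data.Sum.Base using (_⊎_; swap)
open import Data.Vec.Functional using (Vector)
open import Level using (0ℓ)
open import Relation.Binary.Core using (Rel)
open import Relation.Binary.Definitions using (Decidable; Irreflexive; Symmetric)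
import Relation.Binary.Construct.Flip.EqAndOrd as Flip
open import Relation.Binary.PropositionalEquality using (_≡_; _≢_; sym)
open import Relation.Nullary.Decidable using (Dec; does; ¬?; _×-dec_; _⊎-dec_; _→-dec_)

-- The index i : Fin d stands for the vertex v_{i+1}, and for the element i + 1
-- of [d].

------------------------------------------------------------------------
-- Graphs

record SimpleGraph (d : ℕ) : Set₁ where
  field
    Adj    : Rel (Fin d) 0ℓ
    adj?   : Decidable Adj
    symm   : Symmetric Adj
    irrefl : Irreflexive _≡_ Adj

fromRel : ∀ {d} {R : Rel (Fin d) 0ℓ} → Decidable R → SimpleGraph d
fromRel {R = R} R? = record
  { Adj    = λ i j → i ≢ j × (R i j ⊎ R j i)
  ; adj?   = λ i j → ¬? (i Fin.≟ j) ×-dec (R? i j ⊎-dec R? j i)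
  ; symm   = λ (i≢j , r) → (λ j≡i → i≢j (sym j≡i)) , swap r
  ; irrefl = λ i≡j (i≢j , _) → i≢j i≡j
  }

-- The cycle v_1 v_2 ⋯ v_{n+1} v_1 (a genuine cycle for n ≥ 2).
cycle : ∀ n → SimpleGraph (suc n)
cycle n = fromRel {R = λ i j → suc (toℕ i) ≡ toℕ j ⊎ (i ≡ fromℕ n × j ≡ zero)}
  λ i j → (suc (toℕ i) ℕ.≟ toℕ j) ⊎-dec ((i Fin.≟ fromℕ n) ×-dec (j Fin.≟ zero))

addEdge : ∀ {d} → SimpleGraph d → Fin d → Fin d → SimpleGraph d
addEdge G u v = fromRel {R = λ i j → Adj i j ⊎ (i ≡ u × j ≡ v)}
  λ i j → adj? i j ⊎-dec ((i Fin.≟ u) ×-dec (j Fin.≟ v))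
  where open SimpleGraph G

-- The cycle v_1 v_2 ⋯ v_{m+2} v_1 with the edge v_2 v_{m+1} added.
chordedCycle : ∀ m → SimpleGraph (suc (suc m))
chordedCycle m = addEdge (cycle (suc m)) (suc zero) (inject₁ (fromℕ m))

------------------------------------------------------------------------
-- Set partitions

-- Partition d k: the partitions of a d-element set into k blocks. The block
-- structure is built up by prepending elements: the new first element either
-- forms a block of its own (numbered zero) or joins an existing block b. Every
-- set partition arises in exactly one way.
data Partition : ℕ → ℕ → Set where
  []        : Partition 0 0
  singleton : ∀ {d k} → Partition d k → Partition (suc d) (suc k)
  join      : ∀ {d k} → Fin k → Partition d k → Partition (suc d) k

SetPartition : ℕ → Set
SetPartition d = ∃ λ k → Partition d k

blockOf : ∀ {d k} → Partition d k → Fin d → Fin k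
blockOf (singleton π) zero    = zero
blockOf (singleton π) (suc i) = suc (blockOf π i)
blockOf (join b π)    zero    = b
blockOf (join b π)    (suc i) = blockOf π i

SameBlock : ∀ {d} → SetPartition d → Rel (Fin d) 0ℓ
SameBlock (_ , π) i j = blockOf π i ≡ blockOf π j

sameBlock? : ∀ {d} (π : SetPartition d) → Decidable (SameBlock π)
sameBlock? (_ , π) i j = blockOf π i Fin.≟ blockOf π j

setPartitions : ∀ d → List (SetPartition d)
setPartitions zero    = (0 , []) ∷ []
setPartitions (suc d) = concatMap extend (setPartitions d)
  where
  extend : SetPartition d → List (SetPartition (suc d))
  extend (k , π) = (suc k , singleton π) ∷ map (λ b → k , join b π) (allFin k)

blockSize : ∀ {d k} → Partition d k → Fin k → ℕ
blockSize {d} π b = length (filter (λ i → blockOf π i Fin.≟ b) (allFin d))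

-- λ(π), as a weakly decreasing list.
type : ∀ {d} → SetPartition d → List ℕ
type (k , π) = sort (map (blockSize π) (allFin k))
  where open Sort (Flip.decTotalOrder ℕ.≤-decTotalOrder) using (sort)

-- b_π; the element d = n + 1 of [d] is fromℕ n.
lastBlockSize : ∀ {n} → SetPartition (suc n) → ℕ
lastBlockSize {n} (_ , π) = blockSize π (blockOf π (fromℕ n))

infix 4 _∼_ _∼?_

_∼_ : ∀ {n} → Rel (SetPartition (suc n)) 0ℓ
π ∼ σ = type π ≡ type σ × lastBlockSize π ≡ lastBlockSize σ

_∼?_ : ∀ {n} → Decidable (_∼_ {n})
π ∼? σ = List.≡-dec ℕ._≟_ (type π) (type σ) ×-dec (lastBlockSize π ℕ.≟ lastBlockSize σ)

------------------------------------------------------------------------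
-- Series in noncommuting variables, homogeneous of degree d

-- The word w is the monomial x_{w 0} x_{w 1} ⋯ x_{w (d-1)}; the countably many
-- variables (colours) are indexed by ℕ rather than by the positive integers.
Word : ℕ → Set
Word d = Vector ℕ d

-- A series is given by its coefficients.
Series : ℕ → Set
Series d = Word d → ℚ

indicator : ∀ {A : Set} → Dec A → ℚ
indicator a? = if does a? then 1ℚ else 0ℚ

sumℚ : List ℚ → ℚ
sumℚ = foldr _+_ 0ℚ

Proper : ∀ {d} → SimpleGraph d → (Fin d → ℕ) → Set
Proper G κ = ∀ i j → SimpleGraph.Adj G i j → κ i ≢ κ j

proper? : ∀ {d} (G : SimpleGraph d) κ → Dec (Proper G κ)
proper? G κ = all? λ i → all? λ j → SimpleGraph.adj? G i j →-dec ¬? (κ i ℕ.≟ κ j)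

-- Y_G. A map κ from vertices to colours contributes precisely the word κ, so
-- the coefficient of w is 1 or 0 according to whether w is a proper colouring.
Y : ∀ {d} → SimpleGraph d → Series d
Y G w = indicator (proper? G w)

DistinctOnBlocks : ∀ {d} → SetPartition d → Word d → Set
DistinctOnBlocks π w = ∀ j k → j ≢ k → SameBlock π j k → w j ≢ w k

distinctOnBlocks? : ∀ {d} (π : SetPartition d) w → Dec (DistinctOnBlocks π w)
distinctOnBlocks? π w = all? λ j → all? λ k →
  ¬? (j Fin.≟ k) →-dec (sameBlock? π j k →-dec ¬? (w j ℕ.≟ w k))

e : ∀ {d} → SetPartition d → Series d
e π w = indicator (distinctOnBlocks? π w)

eCombination : ∀ {d} → (SetPartition d → ℚ) → Series d
eCombination {d} c w = sumℚ (map (λ σ → c σ * e σ w) (setPartitions d))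

------------------------------------------------------------------------
-- (e)-positivity

classSum : ∀ {n} → (SetPartition (suc n) → ℚ) → SetPartition (suc n) → ℚ
classSum {n} c π = sumℚ (map c (filter (π ∼?_) (setPartitions (suc n))))

-- The e_σ are linearly independent, so the c asserted to exist here is the
-- unique coefficient family of Y_G in the e-basis.
EPositive : ∀ {n} → SimpleGraph (suc n) → Set
EPositive {n} G = ∃ λ (c : SetPartition (suc n) → ℚ) →
  (∀ w → Y G w ≡ eCombination c w) × (∀ π → 0ℚ ≤ classSum c π)

{-# OPTIONS --safe #-}
module Submission where

-- A class sum of coefficients only sees, of each set partition, the size of the block containing the
-- last vertex and the multiset of the other sizes. So Y_G is expanded relative to a pointed vertex,
-- and an expansion is recorded by a linear functional on functions ψ of these sizes. If z has the
-- colour of the pointed vertex v of a block B, then averaging over the choice of v in B gives, at the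
-- level of functionals, [w_z = w_v] e_{B|…} ~ (e_{z|B|…} - e_{zB|…}) / |B|; this is the operator U.
-- Joining a new vertex to the pointed one is then the operator A. Deletion–contraction expresses
-- paths, cycles and finally the chorded cycle through U and A. The resulting functionals satisfy
-- recursions X_n = X⁰_n + Σ_i i ε_i X_{n-1-i} with the same non-negative kernel, and for the chorded
-- cycle the inhomogeneous part is non-negative as well.

open import Defs
open import Data.Nat.Base using (ℕ; _≥_)

open import Data.Bool.Base using (true; false; not; _∧_; if_then_else_)
open import Data.Fin.Base as Fin using (Fin; zero; suc; fromℕ; inject₁; toℕ)
import Data.Fin.Properties as Fin
open import Data.List.Base using (List; []; _∷_; _++_; map; concatMap; filter; length; allFin; tabulate)
open import Data.List.Membership.Propositional using (_∈_; _∉_; lose; find)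
open import Data.List.Membership.Propositional.Properties
  using (∈-concatMap⁺; ∈-concatMap⁻; ∈-map⁺; ∈-map⁻; ∈-filter⁺; ∈-filter⁻; ∈-allFin)
open import Data.List.Membership.Propositional.Properties.WithK using (unique∧set⇒bag)
import Data.List.Properties as List
open import Data.List.Properties
  using (++-assoc; ++-identityʳ; map-++; length-++; length-map; map-cong-local; map-∘; concatMap-cong; map-tabulate)
open import Data.List.Relation.Binary.BagAndSetEquality using (∼bag⇒↭)
open import Data.List.Relation.Binary.Permutation.Propositional as ↭
  using (_↭_; ↭-refl; ↭-sym; ↭-trans; ↭-reflexive; ↭⇒↭ₛ)
open import Data.List.Relation.Binary.Permutation.Propositional.Properties
  using (↭-length; ∈-resp-↭; map⁺; shift; ++⁺ʳ; ++⁺ˡ; ++-comm; ∷↭∷ʳ)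
open import Data.List.Relation.Binary.Permutation.Setoid.Properties using (Unique-resp-↭)
open import Data.List.Relation.Binary.Pointwise using (Pointwise-≡⇒≡)
open import Data.List.Relation.Unary.All as All using (All; []; _∷_; all?)
import Data.List.Relation.Unary.All.Properties as All
open import Data.List.Relation.Unary.AllPairs as AllPairs using (AllPairs; []; _∷_; allPairs?)
import Data.List.Relation.Unary.AllPairs.Properties as AllPairs
open import Data.List.Relation.Unary.Any using (here; there)
open import Data.List.Relation.Unary.Linked using (Linked; [-]; _∷_; linked?)
open import Data.List.Relation.Unary.Sorted.TotalOrder.Properties using (↗↭↗⇒≋)
open import Data.List.Relation.Unary.Unique.Propositional using (Unique)
import Data.List.Relation.Unary.Unique.Propositional.Properties as Unique
import Data.List.Sort as Sort
open import Data.Nat.Base as ℕ using (zero; suc; s≤s)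
open import Data.Nat.Induction using (<-rec)
import Data.Nat.Properties as ℕ
open import Data.Product.Base using (Σ-syntax; ∃; _×_; _,_; proj₁; proj₂; map₂)
import Data.Product.Properties as Product
open import Data.Rational.Base
  using (ℚ; 0ℚ; 1ℚ; _+_; _*_; _-_; -_; 1/_; _≤_; _<_; NonZero; positive; nonNegative)
import Data.Rational.Properties as ℚ
open import Data.Rational.Solver using (module +-*-Solver)
open import Data.Sum.Base using (_⊎_; inj₁; inj₂)
open import Function.Base using (_∘_; _$_; id)
open import Function.Bundles using (_⇔_; mk⇔; Equivalence)
open import Relation.Binary.Bundles using (DecTotalOrder)
import Relation.Binary.Construct.Flip.EqAndOrd as Flip
open import Relation.Binary.Definitions using (DecidableEquality)
open import Relation.Binary.PropositionalEquality
open import Relation.Nullary using (Dec; yes; no; does; ¬_; contradiction)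
open import Relation.Nullary.Decidable using (dec-true; dec-false; dec⇒maybe; does-≡; map′; ¬?; _×-dec_)
open import Relation.Unary using (Decidable)
open import Tactic.RingSolver using (solve-∀)
open import Tactic.RingSolver.Core.AlmostCommutativeRing using (AlmostCommutativeRing; fromCommutativeRing)

open +-*-Solver using (solve; _:=_; _:+_; _:*_; _:-_; con)

-- Averaging over `v` needs all choices of `v` in a block to give the same functional. This is
-- proved without computing it: colour coincidences are power sums, and induction on their size
-- rewrites them in the e-basis with coefficients depending on block sizes only. Differences between
-- two choices then have functional zero, and only `e_{z|B|…}` and `e_{zB|…}` survive. The operators
-- attach a new vertex only to the pointed one, and the pointed one must be the last vertex of the
-- graph in the end. This decides which edges of the chorded cycle are deleted and contracted. The
-- resulting sum has negative terms, so termwise positivity fails. But blocks away from the pointed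
-- vertex are inert, so every term obeys a recursion with the same kernel, and signs need to cancel
-- only in the inhomogeneous part. At `ψ b λs` = (b+1) e_{b+1} ∏ e_{λ+1}, with elementary symmetric
-- functions e_i, the recursions of `G` and `F` become Stanley's generating functions for paths and
-- cycles. The kernel gives their common denominator 1 - Σ (i-1) e_i t^i, and the inhomogeneous
-- parts correspond to the numerators.

ring : AlmostCommutativeRing _ _
ring = fromCommutativeRing ℚ.+-*-commutativeRing λ p → dec⇒maybe (0ℚ ℚ.≟ p)

-- Natural numbers as rationals; non-negativity

ι : ℕ → ℚ
ι zero    = 0ℚ
ι (suc n) = 1ℚ + ι n

+-nonNeg : ∀ {p q} → 0ℚ ≤ p → 0ℚ ≤ q → 0ℚ ≤ p + q
+-nonNeg = ℚ.+-mono-≤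

*-nonNeg : ∀ {p q} → 0ℚ ≤ p → 0ℚ ≤ q → 0ℚ ≤ p * q
*-nonNeg {p} {q} 0≤p 0≤q =
  subst (_≤ p * q) (ℚ.*-zeroʳ p) (ℚ.*-monoˡ-≤-nonNeg p {{nonNegative 0≤p}} 0≤q)

0≤1 : 0ℚ ≤ 1ℚ
0≤1 = ℚ.nonNegative⁻¹ 1ℚ

ι-nonNeg : ∀ n → 0ℚ ≤ ι n
ι-nonNeg zero    = ℚ.≤-refl
ι-nonNeg (suc n) = +-nonNeg 0≤1 (ι-nonNeg n)

-- Functionals on families of blocks

-- ψ b λs weights a family whose pointed block has b + 1 elements and whose other blocks have
-- λ + 1 elements, λ ∈ λs.

Weighting : Set
Weighting = ℕ → List ℕ → ℚ

Functional : Set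
Functional = Weighting → ℚ

infix 4 _≈_

_≈_ : Weighting → Weighting → Set
ψ ≈ χ = ∀ b λs → ψ b λs ≡ χ b λs

Sym : Weighting → Set
Sym ψ = ∀ b {λs μs} → λs ↭ μs → ψ b λs ≡ ψ b μs

NonNeg : Weighting → Set
NonNeg ψ = ∀ b λs → 0ℚ ≤ ψ b λs

infixl 6 _⊖_

_⊖_ : Weighting → Weighting → Weighting
(ψ ⊖ χ) b λs = ψ b λs - χ b λs

ε : ℕ → Weighting → Weighting
ε k ψ b λs = ψ b (k ∷ λs)

-- The effect on functionals of a new vertex that has the same colour as the pointed one (U), that is
-- joined to the pointed one and becomes pointed itself (A), or that is joined to the pointed one (P).
U A P : Weighting → Weighting
U ψ b λs = ψ 0 (b ∷ λs) - ψ (suc b) λs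
A ψ b λs = ι b * ψ 0 (b ∷ λs) + ψ (suc b) λs
P ψ = ε 0 ψ ⊖ U ψ

A^ : ℕ → Weighting → Weighting
A^ zero    ψ = ψ
A^ (suc n) ψ = A (A^ n ψ)

A^-suc : ∀ n ψ → A^ n (A ψ) ≡ A^ (suc n) ψ
A^-suc zero    ψ = refl
A^-suc (suc n) ψ = cong A (A^-suc n ψ)

-- G n and F n belong to the path and the cycle on n + 1 vertices.
G F : ℕ → Functional
G n ψ = A^ n ψ 0 []
F zero    ψ = 0ℚ
F (suc n) ψ = G (suc n) ψ - F n (U ψ)

U-cong : ∀ {ψ χ} → ψ ≈ χ → U ψ ≈ U χ
U-cong eq b λs = cong₂ _-_ (eq 0 (b ∷ λs)) (eq (suc b) λs)

A-cong : ∀ {ψ χ} → ψ ≈ χ → A ψ ≈ A χ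
A-cong eq b λs = cong₂ (λ p q → ι b * p + q) (eq 0 (b ∷ λs)) (eq (suc b) λs)

A^-cong : ∀ n {ψ χ} → ψ ≈ χ → A^ n ψ ≈ A^ n χ
A^-cong zero    eq = eq
A^-cong (suc n) eq = A-cong (A^-cong n eq)

F-cong : ∀ n {ψ χ} → ψ ≈ χ → F n ψ ≡ F n χ
F-cong zero    eq = refl
F-cong (suc n) eq = cong₂ _-_ (A^-cong (suc n) eq 0 []) (F-cong n (U-cong eq))

ε-sym : ∀ {ψ} k → Sym ψ → Sym (ε k ψ)
ε-sym k ψ-sym b p = ψ-sym b (↭.prep k p)

U-sym : ∀ {ψ} → Sym ψ → Sym (U ψ)
U-sym ψ-sym b p = cong₂ _-_ (ψ-sym 0 (↭.prep b p)) (ψ-sym (suc b) p)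

A-sym : ∀ {ψ} → Sym ψ → Sym (A ψ)
A-sym ψ-sym b p = cong₂ (λ p q → ι b * p + q) (ψ-sym 0 (↭.prep b p)) (ψ-sym (suc b) p)

-- A block away from the pointed vertex is inert. Prepending it before or after the block that `U`
-- closes gives lists differing by a transposition, which is where symmetry enters.
U-ε : ∀ {ψ} k → Sym ψ → U (ε k ψ) ≈ ε k (U ψ)
U-ε {ψ} k ψ-sym b λs = cong (_- ψ (suc b) (k ∷ λs)) (ψ-sym 0 (↭.swap k b ↭-refl))

A-ε : ∀ {ψ} k → Sym ψ → A (ε k ψ) ≈ ε k (A ψ)
A-ε {ψ} k ψ-sym b λs = cong (λ p → ι b * p + ψ (suc b) (k ∷ λs)) (ψ-sym 0 (↭.swap k b ↭-refl))

A^-ε : ∀ n {ψ} k → Sym ψ → A^ n (ε k ψ) ≈ ε k (A^ n ψ)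
A^-sym : ∀ n {ψ} → Sym ψ → Sym (A^ n ψ)

A^-sym zero    ψ-sym = ψ-sym
A^-sym (suc n) ψ-sym = A-sym (A^-sym n ψ-sym)

A^-ε zero    k ψ-sym b λs = refl
A^-ε (suc n) k ψ-sym b λs =
  trans (A-cong (A^-ε n k ψ-sym) b λs) (A-ε k (A^-sym n ψ-sym) b λs)

A-⊖ : ∀ ψ χ → A (ψ ⊖ χ) ≈ A ψ ⊖ A χ
A-⊖ ψ χ b λs = solve 5 (λ n p q r s → n :* (p :- q) :+ (r :- s) := n :* p :+ r :- (n :* q :+ s))
  refl (ι b) (ψ 0 (b ∷ λs)) (χ 0 (b ∷ λs)) (ψ (suc b) λs) (χ (suc b) λs)

U-⊖ : ∀ ψ χ → U (ψ ⊖ χ) ≈ U ψ ⊖ U χ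
U-⊖ ψ χ b λs = solve 4 (λ p q r s → (p :- q) :- (r :- s) := p :- r :- (q :- s))
  refl (ψ 0 (b ∷ λs)) (χ 0 (b ∷ λs)) (ψ (suc b) λs) (χ (suc b) λs)

A^-⊖ : ∀ n ψ χ → A^ n (ψ ⊖ χ) ≈ A^ n ψ ⊖ A^ n χ
A^-⊖ zero    ψ χ b λs = refl
A^-⊖ (suc n) ψ χ b λs = trans (A-cong (A^-⊖ n ψ χ) b λs) (A-⊖ (A^ n ψ) (A^ n χ) b λs)

F-⊖ : ∀ n ψ χ → F n (ψ ⊖ χ) ≡ F n ψ - F n χ
F-⊖ zero    ψ χ = refl
F-⊖ (suc n) ψ χ = begin
  G (suc n) (ψ ⊖ χ) - F n (U (ψ ⊖ χ))
    ≡⟨ cong₂ _-_ (A^-⊖ (suc n) ψ χ 0 []) (trans (F-cong n (U-⊖ ψ χ)) (F-⊖ n (U ψ) (U χ))) ⟩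
  (G (suc n) ψ - G (suc n) χ) - (F n (U ψ) - F n (U χ))
    ≡⟨ solve 4 (λ p q r s → (p :- q) :- (r :- s) := p :- r :- (q :- s)) refl
         (G (suc n) ψ) (G (suc n) χ) (F n (U ψ)) (F n (U χ)) ⟩
  F (suc n) ψ - F (suc n) χ ∎
  where open ≡-Reasoning

-- Recursions with a common kernel

-- N j X n ψ = Σ_{i < n} (j + i) X_{n-1-i} (ε_{j+i} ψ)
N : ℕ → (ℕ → Functional) → ℕ → Functional
N j X zero    ψ = 0ℚ
N j X (suc n) ψ = ι j * X n (ε j ψ) + N (suc j) X n ψ

-- This lets `X ∘ T` inherit the recursion of `X`, for each operator `T` that occurs in `Z`.
N-∘ : ∀ (X : ℕ → Functional) (T : Weighting → Weighting) →
      (∀ n {ψ χ} → ψ ≈ χ → X n ψ ≡ X n χ) → (∀ {ψ} k → Sym ψ → T (ε k ψ) ≈ ε k (T ψ)) →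
      ∀ j n {ψ} → Sym ψ → N j (λ k ψ → X k (T ψ)) n ψ ≡ N j X n (T ψ)
N-∘ X T X-cong T-ε j zero    ψ-sym = refl
N-∘ X T X-cong T-ε j (suc n) {ψ} ψ-sym =
  cong₂ (λ p q → ι j * p + q) (X-cong n {T (ε j ψ)} {ε j (T ψ)} (T-ε j ψ-sym)) (N-∘ X T X-cong T-ε (suc j) n ψ-sym)

N-+ : ∀ X Y j n ψ → N j (λ k ψ → X k ψ + Y k ψ) n ψ ≡ N j X n ψ + N j Y n ψ
N-+ X Y j zero    ψ = refl
N-+ X Y j (suc n) ψ rewrite N-+ X Y (suc j) n ψ =
  solve 5 (λ i x y a b → i :* (x :+ y) :+ (a :+ b) := i :* x :+ a :+ (i :* y :+ b)) refl
    (ι j) (X n (ε j ψ)) (Y n (ε j ψ)) (N (suc j) X n ψ) (N (suc j) Y n ψ)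

N-- : ∀ X Y j n ψ → N j (λ k ψ → X k ψ - Y k ψ) n ψ ≡ N j X n ψ - N j Y n ψ
N-- X Y j zero    ψ = refl
N-- X Y j (suc n) ψ rewrite N-- X Y (suc j) n ψ =
  solve 5 (λ i x y a b → i :* (x :- y) :+ (a :- b) := i :* x :+ a :- (i :* y :+ b)) refl
    (ι j) (X n (ε j ψ)) (Y n (ε j ψ)) (N (suc j) X n ψ) (N (suc j) Y n ψ)

-- Shifting the index of `X` gives the sum of length `suc n` without its last term, the one with
-- `X 0`. Such boundary terms are one source of the summands of `Z₀`.
N-suc : ∀ X j n ψ → N j (X ∘ ℕ.suc) n ψ ≡ N j X (suc n) ψ - ι (j ℕ.+ n) * X 0 (ε (j ℕ.+ n) ψ)
N-suc X j zero ψ rewrite ℕ.+-identityʳ j =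
  solve 1 (λ p → con 0ℚ := p :+ con 0ℚ :- p) refl (ι j * X 0 (ε j ψ))
N-suc X j (suc n) ψ rewrite N-suc X (suc j) n ψ | ℕ.+-suc j n =
  solve 3 (λ p q r → p :+ (q :- r) := p :+ q :- r) refl
    (ι j * X (suc n) (ε j ψ)) (N (suc j) X (suc n) ψ) (ι (suc (j ℕ.+ n)) * X 0 (ε (suc (j ℕ.+ n)) ψ))

-- Each `A` either closes the pointed block, with factor `ι j`, and starts a new one, or enlarges
-- it. A closed block is inert by `A^-ε`, so what follows it is a shorter path.
A^-rec : ∀ j n {ψ} → Sym ψ → A^ n ψ j [] ≡ ψ (n ℕ.+ j) [] + N j G n ψ
A^-rec j zero    {ψ} ψ-sym = sym (ℚ.+-identityʳ (ψ j []))
A^-rec j (suc n) {ψ} ψ-sym = begin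
  ι j * A^ n ψ 0 (j ∷ []) + A^ n ψ (suc j) []
    ≡⟨ cong₂ (λ p q → ι j * p + q) (sym (A^-ε n j ψ-sym 0 [])) (A^-rec (suc j) n ψ-sym) ⟩
  ι j * G n (ε j ψ) + (ψ (n ℕ.+ suc j) [] + N (suc j) G n ψ)
    ≡⟨ cong (λ k → ι j * G n (ε j ψ) + (ψ k [] + N (suc j) G n ψ)) (ℕ.+-suc n j) ⟩
  ι j * G n (ε j ψ) + (ψ (suc n ℕ.+ j) [] + N (suc j) G n ψ)
    ≡⟨ solve 3 (λ p q r → p :+ (q :+ r) := q :+ (p :+ r)) refl
         (ι j * G n (ε j ψ)) (ψ (suc n ℕ.+ j) []) (N (suc j) G n ψ) ⟩
  ψ (suc n ℕ.+ j) [] + N j G (suc n) ψ ∎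
  where open ≡-Reasoning

G-rec : ∀ n {ψ} → Sym ψ → G n ψ ≡ ψ n [] + N 0 G n ψ
G-rec n {ψ} ψ-sym = trans (A^-rec 0 n ψ-sym) (cong (λ k → ψ k [] + N 0 G n ψ) (ℕ.+-identityʳ n))

-- The definition of `F` reads `G (suc k) ψ` = `F (suc k) ψ` + `F k (U ψ)`; this is summed over the
-- kernel. Only `G 0` has no such splitting, and it leaves the last summand.
N-G : ∀ j n {ψ} → Sym ψ →
      N j G (suc n) ψ ≡ N j F (suc n) ψ + N j F n (U ψ) + ι (n ℕ.+ j) * ψ 0 (n ℕ.+ j ∷ [])
N-G j zero {ψ} ψ-sym =
  solve 2 (λ p q → p :* q :+ con 0ℚ := p :* con 0ℚ :+ con 0ℚ :+ con 0ℚ :+ p :* q) refl (ι j) (ψ 0 (j ∷ []))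
N-G j (suc n) {ψ} ψ-sym rewrite N-G (suc j) n ψ-sym | ℕ.+-suc n j | sym (F-cong n (U-ε j ψ-sym)) =
  solve 6 (λ p g f a b c → p :* g :+ (a :+ b :+ c) := p :* (g :- f) :+ a :+ (p :* f :+ b) :+ c) refl
    (ι j) (G (suc n) (ε j ψ)) (F n (U (ε j ψ))) (N (suc j) F (suc n) ψ) (N (suc j) F n (U ψ))
    (ι (suc (n ℕ.+ j)) * ψ 0 (suc (n ℕ.+ j) ∷ []))

-- The boundary term of `N-G` cancels the value `ψ 0 (n ∷ [])` inside `U ψ n []`. What remains is
-- `ι n` copies of `ψ (suc n) []` besides the one from the path, which is the numerator i(i-1) e_i
-- for cycles.
F-rec : ∀ n {ψ} → Sym ψ → F n ψ ≡ ι n * ψ n [] + N 0 F n ψ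
F-rec zero    {ψ} ψ-sym = solve 1 (λ p → con 0ℚ := con 0ℚ :* p :+ con 0ℚ) refl (ψ 0 [])
F-rec (suc n) {ψ} ψ-sym = begin
  G (suc n) ψ - F n (U ψ)
    ≡⟨ cong₂ _-_ (G-rec (suc n) ψ-sym) (F-rec n (U-sym ψ-sym)) ⟩
  ψ (suc n) [] + N 0 G (suc n) ψ - (ι n * U ψ n [] + N 0 F n (U ψ))
    ≡⟨ cong (λ r → ψ (suc n) [] + r - (ι n * U ψ n [] + N 0 F n (U ψ))) N-G₀ ⟩
  ψ (suc n) [] + (N 0 F (suc n) ψ + N 0 F n (U ψ) + ι n * ψ 0 (n ∷ [])) - (ι n * U ψ n [] + N 0 F n (U ψ))
    ≡⟨ collect (ι n) (ψ (suc n) []) (ψ 0 (n ∷ [])) (N 0 F (suc n) ψ) (N 0 F n (U ψ)) ⟩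
  ι (suc n) * ψ (suc n) [] + N 0 F (suc n) ψ ∎
  where
  open ≡-Reasoning
  N-G₀ : N 0 G (suc n) ψ ≡ N 0 F (suc n) ψ + N 0 F n (U ψ) + ι n * ψ 0 (n ∷ [])
  N-G₀ = trans (N-G 0 n ψ-sym)
    (cong (λ k → N 0 F (suc n) ψ + N 0 F n (U ψ) + ι k * ψ 0 (k ∷ [])) (ℕ.+-identityʳ n))
  collect : ∀ n p q a b → p + (a + b + n * q) - (n * (q - p) + b) ≡ (1ℚ + n) * p + a
  collect = solve-∀ ring

-- The functional of the chorded cycle whose long cycle has n + 1 vertices, written so that it is
-- linear in F and G; see chordedCycle-functional.
Z : ℕ → Functional
Z n ψ = F n (A (ε 0 ψ)) - F n (A (U ψ)) - (G (2 ℕ.+ n) ψ + G (2 ℕ.+ n) ψ) + F (1 ℕ.+ n) (A ψ)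
        + F (2 ℕ.+ n) ψ + G n (ε 0 (U ψ)) - G n (U (U ψ))

-- The inhomogeneous part Z n - N 0 Z n.
Z₀ : ℕ → Functional
Z₀ n ψ = (ι n - 1ℚ) * ψ (suc n) (0 ∷ []) + (ι n * (ι n - 1ℚ) + 1ℚ) * ψ 1 (n ∷ [])
         + ι n * (ι n - 1ℚ) * ψ 0 (suc n ∷ []) + (ι n + ι n + ι n) * ψ (2 ℕ.+ n) []

N-Z : ∀ n ψ → N 0 Z n ψ ≡
  N 0 (λ k ψ → F k (A (ε 0 ψ))) n ψ - N 0 (λ k ψ → F k (A (U ψ))) n ψ
  - (N 0 (G ∘ ℕ.suc ∘ ℕ.suc) n ψ + N 0 (G ∘ ℕ.suc ∘ ℕ.suc) n ψ)
  + N 0 (λ k ψ → F (suc k) (A ψ)) n ψ + N 0 (F ∘ ℕ.suc ∘ ℕ.suc) n ψ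
  + N 0 (λ k ψ → G k (ε 0 (U ψ))) n ψ - N 0 (λ k ψ → G k (U (U ψ))) n ψ
N-Z n ψ =
  trans (N-- (λ k ψ → F k (A (ε 0 ψ)) - F k (A (U ψ)) - (G (2 ℕ.+ k) ψ + G (2 ℕ.+ k) ψ) + F (1 ℕ.+ k) (A ψ)
                      + F (2 ℕ.+ k) ψ + G k (ε 0 (U ψ))) (λ k ψ → G k (U (U ψ))) 0 n ψ) (cong₂ _-_
  (trans (N-+ (λ k ψ → F k (A (ε 0 ψ)) - F k (A (U ψ)) - (G (2 ℕ.+ k) ψ + G (2 ℕ.+ k) ψ) + F (1 ℕ.+ k) (A ψ)
                      + F (2 ℕ.+ k) ψ) (λ k ψ → G k (ε 0 (U ψ))) 0 n ψ) (cong₂ _+_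
  (trans (N-+ (λ k ψ → F k (A (ε 0 ψ)) - F k (A (U ψ)) - (G (2 ℕ.+ k) ψ + G (2 ℕ.+ k) ψ) + F (1 ℕ.+ k) (A ψ))
                      (F ∘ ℕ.suc ∘ ℕ.suc) 0 n ψ) (cong₂ _+_
  (trans (N-+ (λ k ψ → F k (A (ε 0 ψ)) - F k (A (U ψ)) - (G (2 ℕ.+ k) ψ + G (2 ℕ.+ k) ψ))
              (λ k ψ → F (suc k) (A ψ)) 0 n ψ) (cong₂ _+_
  (trans (N-- (λ k ψ → F k (A (ε 0 ψ)) - F k (A (U ψ))) (λ k ψ → G (2 ℕ.+ k) ψ + G (2 ℕ.+ k) ψ) 0 n ψ)
    (cong₂ _-_ (N-- (λ k ψ → F k (A (ε 0 ψ))) (λ k ψ → F k (A (U ψ))) 0 n ψ)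
               (N-+ (G ∘ ℕ.suc ∘ ℕ.suc) (G ∘ ℕ.suc ∘ ℕ.suc) 0 n ψ)))
  refl)) refl)) refl)) refl)

N-suc₀ : ∀ X n ψ → N 0 X (suc n) ψ ≡ N 0 (X ∘ ℕ.suc) n ψ + ι n * X 0 (ε n ψ)
N-suc₀ X n ψ = trans (add-back _ _) (cong (_+ ι n * X 0 (ε n ψ)) (sym (N-suc X 0 n ψ)))
  where
  add-back : ∀ p q → p ≡ p - q + q
  add-back = solve-∀ ring

G-rec₂ : ∀ n {ψ} → Sym ψ →
         G (2 ℕ.+ n) ψ ≡ ψ (2 ℕ.+ n) [] + (N 0 (G ∘ ℕ.suc ∘ ℕ.suc) n ψ + ι n * ψ 1 (n ∷ []) + ι (suc n) * ψ 0 (suc n ∷ []))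
G-rec₂ n {ψ} ψ-sym = begin
  G (2 ℕ.+ n) ψ
    ≡⟨ G-rec (2 ℕ.+ n) ψ-sym ⟩
  ψ (2 ℕ.+ n) [] + N 0 G (2 ℕ.+ n) ψ
    ≡⟨ cong (ψ (2 ℕ.+ n) [] +_) (N-suc₀ G (suc n) ψ) ⟩
  ψ (2 ℕ.+ n) [] + (N 0 (G ∘ ℕ.suc) (suc n) ψ + ι (suc n) * ψ 0 (suc n ∷ []))
    ≡⟨ cong (λ r → ψ (2 ℕ.+ n) [] + (r + ι (suc n) * ψ 0 (suc n ∷ []))) (N-suc₀ (G ∘ ℕ.suc) n ψ) ⟩
  ψ (2 ℕ.+ n) [] + (N 0 (G ∘ ℕ.suc ∘ ℕ.suc) n ψ + ι n * G 1 (ε n ψ) + ι (suc n) * ψ 0 (suc n ∷ []))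
    ≡⟨ cong (λ r → ψ (2 ℕ.+ n) [] + (N 0 (G ∘ ℕ.suc ∘ ℕ.suc) n ψ + ι n * r + ι (suc n) * ψ 0 (suc n ∷ [])))
         (drop₀ (ψ 0 (n ∷ 0 ∷ [])) (ψ 1 (n ∷ []))) ⟩
  ψ (2 ℕ.+ n) [] + (N 0 (G ∘ ℕ.suc ∘ ℕ.suc) n ψ + ι n * ψ 1 (n ∷ []) + ι (suc n) * ψ 0 (suc n ∷ [])) ∎
  where
  open ≡-Reasoning
  drop₀ : ∀ p q → 0ℚ * p + q ≡ q
  drop₀ = solve-∀ ring

F-rec₁ : ∀ n {ψ} → Sym ψ → F (1 ℕ.+ n) ψ ≡ ι (1 ℕ.+ n) * ψ (1 ℕ.+ n) [] + N 0 (F ∘ ℕ.suc) n ψ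
F-rec₁ n {ψ} ψ-sym =
  trans (F-rec (1 ℕ.+ n) ψ-sym)
    (cong (ι (1 ℕ.+ n) * ψ (1 ℕ.+ n) [] +_) (trans (N-suc₀ F n ψ) (drop₀ (N 0 (F ∘ ℕ.suc) n ψ) (ι n))))
  where
  drop₀ : ∀ p q → p + q * 0ℚ ≡ p
  drop₀ = solve-∀ ring

F-rec₂ : ∀ n {ψ} → Sym ψ →
         F (2 ℕ.+ n) ψ ≡ ι (2 ℕ.+ n) * ψ (2 ℕ.+ n) [] + (N 0 (F ∘ ℕ.suc ∘ ℕ.suc) n ψ + ι n * ψ 1 (n ∷ []))
F-rec₂ n {ψ} ψ-sym = begin
  F (2 ℕ.+ n) ψ
    ≡⟨ F-rec₁ (suc n) ψ-sym ⟩
  ι (2 ℕ.+ n) * ψ (2 ℕ.+ n) [] + N 0 (F ∘ ℕ.suc) (suc n) ψ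
    ≡⟨ cong (ι (2 ℕ.+ n) * ψ (2 ℕ.+ n) [] +_) (N-suc₀ (F ∘ ℕ.suc) n ψ) ⟩
  ι (2 ℕ.+ n) * ψ (2 ℕ.+ n) [] + (N 0 (F ∘ ℕ.suc ∘ ℕ.suc) n ψ + ι n * F 1 (ε n ψ))
    ≡⟨ cong (λ r → ι (2 ℕ.+ n) * ψ (2 ℕ.+ n) [] + (N 0 (F ∘ ℕ.suc ∘ ℕ.suc) n ψ + ι n * r))
         (drop₀ (ψ 0 (n ∷ 0 ∷ [])) (ψ 1 (n ∷ []))) ⟩
  ι (2 ℕ.+ n) * ψ (2 ℕ.+ n) [] + (N 0 (F ∘ ℕ.suc ∘ ℕ.suc) n ψ + ι n * ψ 1 (n ∷ [])) ∎
  where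
  open ≡-Reasoning
  drop₀ : ∀ p q → 0ℚ * p + q - 0ℚ ≡ q
  drop₀ = solve-∀ ring

-- Every term of `Z` is `F` or `G` at a shifted index after an operator commuting with all `ε k`.
-- Hence the kernel sums reassemble to `N 0 Z n`, and only inhomogeneous and boundary terms have to
-- be collected.
Z-rec : ∀ n {ψ} → Sym ψ → Z n ψ ≡ Z₀ n ψ + N 0 Z n ψ
Z-rec n {ψ} ψ-sym = begin
  Z n ψ
    ≡⟨ cong₂ _-_ (cong₂ _+_ (cong₂ _+_ (cong₂ _+_ (cong₂ _-_ (cong₂ _-_ recA recB) (cong₂ _+_ recC recC)) recD) recE) recF) recG ⟩
  (ι n * A (ε 0 ψ) n [] + NA) - (ι n * A (U ψ) n [] + NB)
    - ((ψ (2 ℕ.+ n) [] + (NC + ι n * ψ 1 (n ∷ []) + ι (suc n) * ψ 0 (suc n ∷ [])))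
       + (ψ (2 ℕ.+ n) [] + (NC + ι n * ψ 1 (n ∷ []) + ι (suc n) * ψ 0 (suc n ∷ []))))
    + (ι (suc n) * A ψ (suc n) [] + ND)
    + (ι (2 ℕ.+ n) * ψ (2 ℕ.+ n) [] + (NE + ι n * ψ 1 (n ∷ [])))
    + (U ψ n (0 ∷ []) + NF) - (U (U ψ) n [] + NG)
    -- The inhomogeneous terms with three blocks, of indices 0, 0 and `n`, cancel completely, but
    -- only after `0 ∷ n ∷ []` and `n ∷ 0 ∷ []` are identified by symmetry, here and in the next
    -- step.
    ≡⟨ cong (λ r → (ι n * (ι n * r + ψ (suc n) (0 ∷ [])) + NA) - (ι n * A (U ψ) n [] + NB)
    - ((ψ (2 ℕ.+ n) [] + (NC + ι n * ψ 1 (n ∷ []) + ι (suc n) * ψ 0 (suc n ∷ [])))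
       + (ψ (2 ℕ.+ n) [] + (NC + ι n * ψ 1 (n ∷ []) + ι (suc n) * ψ 0 (suc n ∷ []))))
    + (ι (suc n) * A ψ (suc n) [] + ND)
    + (ι (2 ℕ.+ n) * ψ (2 ℕ.+ n) [] + (NE + ι n * ψ 1 (n ∷ [])))
    + (U ψ n (0 ∷ []) + NF) - (U (U ψ) n [] + NG)) (ψ-sym 0 (↭.swap 0 n ↭-refl)) ⟩
  (ι n * (ι n * ψ 0 (n ∷ 0 ∷ []) + ψ (suc n) (0 ∷ [])) + NA) - (ι n * A (U ψ) n [] + NB)
    - ((ψ (2 ℕ.+ n) [] + (NC + ι n * ψ 1 (n ∷ []) + ι (suc n) * ψ 0 (suc n ∷ [])))
       + (ψ (2 ℕ.+ n) [] + (NC + ι n * ψ 1 (n ∷ []) + ι (suc n) * ψ 0 (suc n ∷ []))))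
    + (ι (suc n) * A ψ (suc n) [] + ND)
    + (ι (2 ℕ.+ n) * ψ (2 ℕ.+ n) [] + (NE + ι n * ψ 1 (n ∷ [])))
    + (U ψ n (0 ∷ []) + NF) - (U (U ψ) n [] + NG)
    ≡⟨ cong (λ r → (ι n * (ι n * ψ 0 (n ∷ 0 ∷ []) + ψ (suc n) (0 ∷ [])) + NA)
    - (ι n * (ι n * (r - ψ 1 (n ∷ [])) + U ψ (suc n) []) + NB)
    - ((ψ (2 ℕ.+ n) [] + (NC + ι n * ψ 1 (n ∷ []) + ι (suc n) * ψ 0 (suc n ∷ [])))
       + (ψ (2 ℕ.+ n) [] + (NC + ι n * ψ 1 (n ∷ []) + ι (suc n) * ψ 0 (suc n ∷ []))))
    + (ι (suc n) * A ψ (suc n) [] + ND)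
    + (ι (2 ℕ.+ n) * ψ (2 ℕ.+ n) [] + (NE + ι n * ψ 1 (n ∷ [])))
    + (U ψ n (0 ∷ []) + NF) - (r - ψ 1 (n ∷ []) - U ψ (suc n) [] + NG)) (ψ-sym 0 (↭.swap 0 n ↭-refl)) ⟩
  _
    ≡⟨ collect (ι n) (ψ 0 (n ∷ 0 ∷ [])) (ψ (suc n) (0 ∷ [])) (ψ 1 (n ∷ [])) (ψ 0 (suc n ∷ [])) (ψ (2 ℕ.+ n) [])
         NA NB NC ND NE NF NG ⟩
  Z₀ n ψ + (NA - NB - (NC + NC) + ND + NE + NF - NG)
    ≡⟨ cong (Z₀ n ψ +_) (sym (N-Z n ψ)) ⟩
  Z₀ n ψ + N 0 Z n ψ ∎
  where
  open ≡-Reasoning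
  NA = N 0 (λ k ψ → F k (A (ε 0 ψ))) n ψ
  NB = N 0 (λ k ψ → F k (A (U ψ))) n ψ
  NC = N 0 (G ∘ ℕ.suc ∘ ℕ.suc) n ψ
  ND = N 0 (λ k ψ → F (suc k) (A ψ)) n ψ
  NE = N 0 (F ∘ ℕ.suc ∘ ℕ.suc) n ψ
  NF = N 0 (λ k ψ → G k (ε 0 (U ψ))) n ψ
  NG = N 0 (λ k ψ → G k (U (U ψ))) n ψ
  recA : F n (A (ε 0 ψ)) ≡ ι n * A (ε 0 ψ) n [] + NA
  recA = trans (F-rec n (A-sym (ε-sym 0 ψ-sym))) (cong (ι n * A (ε 0 ψ) n [] +_)
    (sym (N-∘ F (λ ψ → A (ε 0 ψ)) F-cong A-ε-ε 0 n ψ-sym)))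
    where
    A-ε-ε : ∀ {ψ} k → Sym ψ → A (ε 0 (ε k ψ)) ≈ ε k (A (ε 0 ψ))
    A-ε-ε {ψ} k ψ-sym b λs = trans (A-cong {ε 0 (ε k ψ)} {ε k (ε 0 ψ)} (λ b λs → ψ-sym b (↭.swap k 0 ↭-refl)) b λs)
                               (A-ε k (ε-sym 0 ψ-sym) b λs)
  recB : F n (A (U ψ)) ≡ ι n * A (U ψ) n [] + NB
  recB = trans (F-rec n (A-sym (U-sym ψ-sym))) (cong (ι n * A (U ψ) n [] +_)
    (sym (N-∘ F (λ ψ → A (U ψ)) F-cong
      (λ k ψ-sym b λs → trans (A-cong (U-ε k ψ-sym) b λs) (A-ε k (U-sym ψ-sym) b λs)) 0 n ψ-sym)))
  recC : G (2 ℕ.+ n) ψ ≡ ψ (2 ℕ.+ n) [] + (NC + ι n * ψ 1 (n ∷ []) + ι (suc n) * ψ 0 (suc n ∷ []))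
  recC = G-rec₂ n ψ-sym
  recD : F (suc n) (A ψ) ≡ ι (suc n) * A ψ (suc n) [] + ND
  recD = trans (F-rec₁ n (A-sym ψ-sym)) (cong (ι (suc n) * A ψ (suc n) [] +_)
    (sym (N-∘ (F ∘ ℕ.suc) A (λ n → F-cong (suc n)) A-ε 0 n ψ-sym)))
  recE : F (2 ℕ.+ n) ψ ≡ ι (2 ℕ.+ n) * ψ (2 ℕ.+ n) [] + (NE + ι n * ψ 1 (n ∷ []))
  recE = F-rec₂ n ψ-sym
  recF : G n (ε 0 (U ψ)) ≡ U ψ n (0 ∷ []) + NF
  recF = trans (G-rec n (ε-sym 0 (U-sym ψ-sym))) (cong (U ψ n (0 ∷ []) +_)
    (sym (N-∘ G (λ ψ → ε 0 (U ψ)) (λ n eq → A^-cong n eq 0 []) U-ε-ε 0 n ψ-sym)))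
    where
    U-ε-ε : ∀ {ψ} k → Sym ψ → ε 0 (U (ε k ψ)) ≈ ε k (ε 0 (U ψ))
    U-ε-ε k ψ-sym b λs = trans (U-ε k ψ-sym b (0 ∷ λs)) (U-sym ψ-sym b (↭.swap k 0 ↭-refl))
  recG : G n (U (U ψ)) ≡ U (U ψ) n [] + NG
  recG = trans (G-rec n (U-sym (U-sym ψ-sym))) (cong (U (U ψ) n [] +_)
    (sym (N-∘ G (λ ψ → U (U ψ)) (λ n eq → A^-cong n eq 0 [])
      (λ k ψ-sym b λs → trans (U-cong (U-ε k ψ-sym) b λs) (U-ε k (U-sym ψ-sym) b λs)) 0 n ψ-sym)))
  collect : ∀ n p q r s t a b c d e f g →
    (n * (n * p + q) + a) - (n * (n * (p - r) + (s - t)) + b)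
    - ((t + (c + n * r + (1ℚ + n) * s)) + (t + (c + n * r + (1ℚ + n) * s)))
    + ((1ℚ + n) * ((1ℚ + n) * s + t) + d)
    + ((1ℚ + (1ℚ + n)) * t + (e + n * r)) + (p - q + f) - (p - r - (s - t) + g)
    ≡ (n - 1ℚ) * q + (n * (n - 1ℚ) + 1ℚ) * r + n * (n - 1ℚ) * s + (n + n + n) * t
      + (a - b - (c + c) + d + e + f - g)
  collect = solve-∀ ring

Z₀-nonNeg : ∀ n {ψ} → NonNeg ψ → 0ℚ ≤ Z₀ n ψ
-- At `n` = 0 the coefficient of `ψ (suc n) (0 ∷ [])` is -1, but this value coincides with
-- `ψ 1 (n ∷ [])`, whose coefficient is 1.
Z₀-nonNeg zero    {ψ} ψ≥0 = ℚ.≤-reflexive (vanish (ψ 1 (0 ∷ [])) (ψ 0 (1 ∷ [])) (ψ 2 []))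
  where
  vanish : ∀ p q r → 0ℚ ≡ (0ℚ - 1ℚ) * p + (0ℚ * (0ℚ - 1ℚ) + 1ℚ) * p + 0ℚ * (0ℚ - 1ℚ) * q + (0ℚ + 0ℚ + 0ℚ) * r
  vanish = solve-∀ ring
Z₀-nonNeg (suc n) {ψ} ψ≥0 =
  subst (0ℚ ≤_) (expand (ι n) (ψ (2 ℕ.+ n) (0 ∷ [])) (ψ 1 (suc n ∷ [])) (ψ 0 (2 ℕ.+ n ∷ [])) (ψ (3 ℕ.+ n) []))
    (+-nonNeg (+-nonNeg (+-nonNeg
      (*-nonNeg n≥0 (ψ≥0 _ _))
      (*-nonNeg (+-nonNeg (*-nonNeg n+1≥0 n≥0) 0≤1) (ψ≥0 _ _)))
      (*-nonNeg (*-nonNeg n+1≥0 n≥0) (ψ≥0 _ _)))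
      (*-nonNeg (+-nonNeg (+-nonNeg n+1≥0 n+1≥0) n+1≥0) (ψ≥0 _ _)))
  where
  n≥0 = ι-nonNeg n
  n+1≥0 = ι-nonNeg (suc n)
  expand : ∀ n p q r s →
    n * p + ((1ℚ + n) * n + 1ℚ) * q + (1ℚ + n) * n * r + ((1ℚ + n) + (1ℚ + n) + (1ℚ + n)) * s
    ≡ (1ℚ + n - 1ℚ) * p + ((1ℚ + n) * (1ℚ + n - 1ℚ) + 1ℚ) * q + (1ℚ + n) * (1ℚ + n - 1ℚ) * r
      + ((1ℚ + n) + (1ℚ + n) + (1ℚ + n)) * s
  expand = solve-∀ ring

N-nonNeg : ∀ X j n {ψ} → Sym ψ → NonNeg ψ →
           (∀ {k} → k ℕ.< n → ∀ {χ} → Sym χ → NonNeg χ → 0ℚ ≤ X k χ) → 0ℚ ≤ N j X n ψ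
N-nonNeg X j zero    ψ-sym ψ≥0 X≥0 = ℚ.≤-refl
N-nonNeg X j (suc n) ψ-sym ψ≥0 X≥0 = +-nonNeg
  (*-nonNeg (ι-nonNeg j) (X≥0 ℕ.≤-refl (ε-sym j ψ-sym) (λ b λs → ψ≥0 b (j ∷ λs))))
  (N-nonNeg X (suc j) n ψ-sym ψ≥0 (λ k<n → X≥0 (ℕ.m≤n⇒m≤1+n k<n)))

Z-nonNeg : ∀ n {ψ} → Sym ψ → NonNeg ψ → 0ℚ ≤ Z n ψ
Z-nonNeg = <-rec (λ n → ∀ {ψ} → Sym ψ → NonNeg ψ → 0ℚ ≤ Z n ψ) λ n rec {ψ} ψ-sym ψ≥0 →
  subst (0ℚ ≤_) (sym (Z-rec n ψ-sym))
    (+-nonNeg (Z₀-nonNeg n ψ≥0) (N-nonNeg Z 0 n ψ-sym ψ≥0 rec))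

-- The left side comes from deletion-contraction and contains `F ∘ U` at different indices. Reading
-- `F (suc k) ψ = G (suc k) ψ - F k (U ψ)` backwards trades these for values of `F` and `G` to which
-- the recursions apply uniformly.
chordedCycle-functional : ∀ n {ψ} → Sym ψ →
  F (suc n) (A (P ψ)) - F (suc n) (U (A ψ)) + U (A^ (suc n) (U ψ)) 0 [] - F n (U (U (U ψ))) ≡ Z (suc n) ψ
chordedCycle-functional n {ψ} ψ-sym = begin
  F (suc n) (A (P ψ)) - F (suc n) (U (A ψ)) + (χ 0 (0 ∷ []) - χ 1 []) - F n (U (U (U ψ)))
    ≡⟨ cong₂ (λ p q → p - F (suc n) (U (A ψ)) + (q - χ 1 []) - F n (U (U (U ψ))))
         (trans (F-cong (suc n) (A-⊖ (ε 0 ψ) (U ψ))) (F-⊖ (suc n) (A (ε 0 ψ)) (A (U ψ))))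
         (sym (A^-ε (suc n) 0 (U-sym ψ-sym) 0 [])) ⟩
  F (suc n) (A (ε 0 ψ)) - F (suc n) (A (U ψ)) - F (suc n) (U (A ψ)) + (G (suc n) (ε 0 (U ψ)) - χ 1 [])
    - F n (U (U (U ψ)))
    -- As `ι 0` vanishes, `χ 1 []` is `A χ 0 []`, that is `G (2 ℕ.+ n) (U ψ)`. Together with the
    -- last two `G` and `F` terms it unfolds `F (2 ℕ.+ n) (U ψ)` twice.
    ≡⟨ rearrange (F (suc n) (A (ε 0 ψ))) (F (suc n) (A (U ψ))) (F (suc n) (U (A ψ))) (G (suc n) (ε 0 (U ψ)))
         (χ 0 (0 ∷ [])) (χ 1 []) (F n (U (U (U ψ)))) (G (2 ℕ.+ n) (A ψ)) (G (suc n) (U (U ψ))) ⟩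
  F (suc n) (A (ε 0 ψ)) - F (suc n) (A (U ψ)) - (G (2 ℕ.+ n) (A ψ) + G (2 ℕ.+ n) (A ψ)) + F (2 ℕ.+ n) (A ψ)
    + (G (2 ℕ.+ n) (A ψ) - F (2 ℕ.+ n) (U ψ)) + G (suc n) (ε 0 (U ψ)) - G (suc n) (U (U ψ))
    ≡⟨ cong (λ χ → F (suc n) (A (ε 0 ψ)) - F (suc n) (A (U ψ)) - (χ 0 [] + χ 0 []) + F (2 ℕ.+ n) (A ψ)
         + (χ 0 [] - F (2 ℕ.+ n) (U ψ)) + G (suc n) (ε 0 (U ψ)) - G (suc n) (U (U ψ))) (A^-suc (2 ℕ.+ n) ψ) ⟩
  Z (suc n) ψ ∎
  where
  open ≡-Reasoning
  χ = A^ (suc n) (U ψ)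
  rearrange : ∀ a b c d e f g h k →
    a - b - c + (d - f) - g ≡ a - b - (h + h) + (h - c) + (h - (0ℚ * e + f - (k - g))) + d - k
  rearrange = solve-∀ ring

-- Colour comparisons

eq ne : ℕ → ℕ → ℚ
eq a b = indicator (a ℕ.≟ b)
ne a b = 1ℚ - eq a b

indicator-yes : ∀ {X : Set} (x? : Dec X) → X → indicator x? ≡ 1ℚ
indicator-yes x? x = cong (if_then 1ℚ else 0ℚ) (dec-true x? x)

indicator-no : ∀ {X : Set} (x? : Dec X) → ¬ X → indicator x? ≡ 0ℚ
indicator-no x? ¬x = cong (if_then 1ℚ else 0ℚ) (dec-false x? ¬x)

eq-yes : ∀ {a b} → a ≡ b → eq a b ≡ 1ℚ
eq-yes {a} {b} = indicator-yes (a ℕ.≟ b)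

eq-no : ∀ {a b} → a ≢ b → eq a b ≡ 0ℚ
eq-no {a} {b} = indicator-no (a ℕ.≟ b)

eq-refl : ∀ a → eq a a ≡ 1ℚ
eq-refl a = eq-yes {a} refl

eq-sym : ∀ a b → eq a b ≡ eq b a
eq-sym a b = dec-elim (a ℕ.≟ b)
  where
  dec-elim : Dec (a ≡ b) → eq a b ≡ eq b a
  dec-elim (yes a≡b) = trans (eq-yes a≡b) (sym (eq-yes (sym a≡b)))
  dec-elim (no a≢b)  = trans (eq-no a≢b) (sym (eq-no (a≢b ∘ sym)))

ne-sym : ∀ a b → ne a b ≡ ne b a
ne-sym a b = cong (λ r → 1ℚ - r) (eq-sym a b)

eq-subst : ∀ (f : ℕ → ℚ) a b → eq a b * f a ≡ eq a b * f b
eq-subst f a b with a ℕ.≟ b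
... | yes refl = refl
... | no a≢b   rewrite eq-no a≢b = trans (ℚ.*-zeroˡ (f a)) (sym (ℚ.*-zeroˡ (f b)))

ne-idem : ∀ a b → ne a b * ne a b ≡ ne a b
ne-idem a b with a ℕ.≟ b
... | yes a≡b rewrite eq-yes a≡b = refl
... | no a≢b  rewrite eq-no a≢b  = refl

-- Finite sums and the choice of one list entry

∑ : ∀ {X : Set} → (X → ℚ) → List X → ℚ
∑ f xs = sumℚ (map f xs)

∑-cong-All : ∀ {X : Set} {f g : X → ℚ} {xs} → All (λ x → f x ≡ g x) xs → ∑ f xs ≡ ∑ g xs
∑-cong-All []         = refl
∑-cong-All (eq ∷ eqs) = cong₂ _+_ eq (∑-cong-All eqs)

∑-cong : ∀ {X : Set} {f g : X → ℚ} → (∀ x → f x ≡ g x) → ∀ xs → ∑ f xs ≡ ∑ g xs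
∑-cong f≗g xs = ∑-cong-All (All.universal f≗g xs)

∑-map : ∀ {X Y : Set} (f : Y → ℚ) (g : X → Y) xs → ∑ f (map g xs) ≡ ∑ (f ∘ g) xs
∑-map f g []       = refl
∑-map f g (x ∷ xs) = cong (f (g x) +_) (∑-map f g xs)

∑-+ : ∀ {X : Set} (f g : X → ℚ) xs → ∑ (λ x → f x + g x) xs ≡ ∑ f xs + ∑ g xs
∑-+ f g []       = refl
∑-+ f g (x ∷ xs) = trans (cong (f x + g x +_) (∑-+ f g xs)) (interchange (f x) (g x) (∑ f xs) (∑ g xs))
  where
  interchange : ∀ a b c d → a + b + (c + d) ≡ a + c + (b + d)
  interchange = solve-∀ ring

∑-* : ∀ {X : Set} a (f : X → ℚ) xs → ∑ (λ x → a * f x) xs ≡ a * ∑ f xs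
∑-* a f []       = sym (ℚ.*-zeroʳ a)
∑-* a f (x ∷ xs) = trans (cong (a * f x +_) (∑-* a f xs)) (sym (ℚ.*-distribˡ-+ a (f x) (∑ f xs)))

∑-const : ∀ {X : Set} a (xs : List X) → ∑ (λ _ → a) xs ≡ ι (length xs) * a
∑-const a []       = sym (ℚ.*-zeroˡ a)
∑-const a (x ∷ xs) = trans (cong (a +_) (∑-const a xs)) (factor a (ι (length xs)))
  where
  factor : ∀ a n → a + n * a ≡ (1ℚ + n) * a
  factor = solve-∀ ring

picks : ∀ {X : Set} → List X → List (X × List X)
picks []       = []
picks (x ∷ xs) = (x , xs) ∷ map (map₂ (x ∷_)) (picks xs)

length-picks : ∀ {X : Set} (xs : List X) → length (picks xs) ≡ length xs
length-picks []       = refl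
length-picks (x ∷ xs) = cong suc (trans (length-map (map₂ (x ∷_)) (picks xs)) (length-picks xs))

picks-↭ : ∀ {X : Set} (xs : List X) → All (λ (y , ys) → y ∷ ys ↭ xs) (picks xs)
picks-↭ []       = []
picks-↭ (x ∷ xs) = ↭-refl ∷ All.map⁺ (All.map (λ {(y , ys)} p → ↭-trans (↭.swap y x ↭-refl) (↭.prep x p)) (picks-↭ xs))

-- Factorials

ι-positive : ∀ n → 0ℚ < ι (suc n)
ι-positive n = ℚ.+-mono-<-≤ (ℚ.positive⁻¹ 1ℚ) (ι-nonNeg n)

ι-nonZero : ∀ {n} → NonZero (ι (suc n))
ι-nonZero {n} = ℚ.pos⇒nonZero (ι (suc n)) {{positive (ι-positive n)}}

recip : ℕ → ℚ
recip n = 1/_ (ι (suc n)) {{ι-nonZero {n}}}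

recip-inverse : ∀ n → recip n * ι (suc n) ≡ 1ℚ
recip-inverse n = ℚ.*-inverseˡ (ι (suc n)) {{ι-nonZero {n}}}

fact : ℕ → ℚ
fact zero    = 1ℚ
fact (suc n) = ι (suc n) * fact n

facts : List ℕ → ℚ
facts []       = 1ℚ
facts (l ∷ λs) = fact (suc l) * facts λs

-- The number of ways to order the elements of every block with the pointed vertex first in its own.
-- The factor b + 1 missing for the pointed block absorbs the denominator of the averaging.
weight : ℕ → List ℕ → ℚ
weight b λs = fact b * facts λs

swap-factors : ∀ a b c → a * (b * c) ≡ b * (a * c)
swap-factors = solve-∀ ring

-- signedFact k is the coefficient of the power sum p_{[k+1]} in e_{[k+1]}.
signedFact signedRecip : ℕ → ℚ
signedFact zero    = 1ℚ
signedFact (suc k) = - (ι (suc k) * signedFact k)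
signedRecip zero    = 1ℚ
signedRecip (suc k) = - (recip k * signedRecip k)

signedFact-inverse : ∀ k → signedRecip k * signedFact k ≡ 1ℚ
signedFact-inverse zero    = refl
signedFact-inverse (suc k) = trans (regroup (recip k) (signedRecip k) (ι (suc k)) (signedFact k)) (cong₂ _*_ (recip-inverse k) (signedFact-inverse k))
  where
  regroup : ∀ r a n b → - (r * a) * - (n * b) ≡ r * n * (a * b)
  regroup = solve-∀ ring

-- Paths and cycles

path : List ℕ → ℚ
path (a ∷ b ∷ as) = ne a b * path (b ∷ as)
path _            = 1ℚ

path-∷ʳ : ∀ a as b c → path (a ∷ as ++ b ∷ c ∷ []) ≡ path (a ∷ as ++ b ∷ []) * ne b c
path-∷ʳ a []       b c = move (ne a b) (ne b c)
  where
  move : ∀ p q → p * (q * 1ℚ) ≡ p * 1ℚ * q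
  move = solve-∀ ring
path-∷ʳ a (d ∷ as) b c = trans (cong (ne a d *_) (path-∷ʳ d as b c)) (sym (ℚ.*-assoc (ne a d) _ _))

-- The four-cycle x d v y over the edge xy, with K a weight of the colours of the remaining graph;
-- L is the value of K when x and y have the same colour.
four-cycle : ∀ v d x y K L → eq x y * K ≡ eq x y * L →
  ne v d * (ne d x * (ne x y * K)) - ne d v * (eq v y * (K * ne x y))
    + eq d x * (eq v y * 1ℚ * K) - eq d v * (eq v x * (eq x y * L))
  ≡ ne v y * (K * ne x d) * ne v d * ne y x
four-cycle v d x y K L K≡L = trans (cong (λ r → ne v d * (ne d x * (ne x y * K)) - ne d v * (eq v y * (K * ne x y))
    + eq d x * (eq v y * 1ℚ * K) - eq d v * (eq v x * r)) (sym K≡L)) (cases (x ℕ.≟ y) (v ℕ.≟ y) (d ℕ.≟ x))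
  where
  Goal : Set
  Goal = ne v d * (ne d x * (ne x y * K)) - ne d v * (eq v y * (K * ne x y))
    + eq d x * (eq v y * 1ℚ * K) - eq d v * (eq v x * (eq x y * K))
    ≡ ne v y * (K * ne x d) * ne v d * ne y x
  cases : Dec (x ≡ y) → Dec (v ≡ y) → Dec (d ≡ x) → Goal
  cases (yes refl) (yes refl) _ rewrite eq-refl x = same (eq x d) (eq d x) K
    where
    same : ∀ a b K → (1ℚ - a) * ((1ℚ - b) * ((1ℚ - 1ℚ) * K)) - (1ℚ - b) * (1ℚ * (K * (1ℚ - 1ℚ)))
      + b * (1ℚ * 1ℚ * K) - b * (1ℚ * (1ℚ * K)) ≡ (1ℚ - 1ℚ) * (K * (1ℚ - a)) * (1ℚ - a) * (1ℚ - 1ℚ)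
    same = solve-∀ ring
  cases (yes refl) (no v≢y) _ rewrite eq-refl x | eq-no v≢y = same (eq v d) (eq d x) (eq d v) (eq x d) K
    where
    same : ∀ a b c e K → (1ℚ - a) * ((1ℚ - b) * ((1ℚ - 1ℚ) * K)) - (1ℚ - c) * (0ℚ * (K * (1ℚ - 1ℚ)))
      + b * (0ℚ * 1ℚ * K) - c * (0ℚ * (1ℚ * K)) ≡ (1ℚ - 0ℚ) * (K * (1ℚ - e)) * (1ℚ - a) * (1ℚ - 1ℚ)
    same = solve-∀ ring
  cases (no x≢y) (yes refl) (yes refl) rewrite eq-refl x | eq-refl v | eq-no x≢y | eq-no (x≢y ∘ sym) = same K
    where
    same : ∀ K → (1ℚ - 0ℚ) * ((1ℚ - 1ℚ) * ((1ℚ - 0ℚ) * K)) - (1ℚ - 0ℚ) * (1ℚ * (K * (1ℚ - 0ℚ)))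
      + 1ℚ * (1ℚ * 1ℚ * K) - 0ℚ * (0ℚ * (0ℚ * K)) ≡ (1ℚ - 1ℚ) * (K * (1ℚ - 1ℚ)) * (1ℚ - 0ℚ) * (1ℚ - 0ℚ)
    same = solve-∀ ring
  cases (no x≢y) (yes refl) (no d≢x) rewrite eq-refl v | eq-no x≢y | eq-no d≢x | eq-sym d v | eq-no (x≢y ∘ sym) =
    same (eq v d) (eq x d) K
    where
    same : ∀ a b K → (1ℚ - a) * ((1ℚ - 0ℚ) * ((1ℚ - 0ℚ) * K)) - (1ℚ - a) * (1ℚ * (K * (1ℚ - 0ℚ)))
      + 0ℚ * (1ℚ * 1ℚ * K) - a * (0ℚ * (0ℚ * K)) ≡ (1ℚ - 1ℚ) * (K * (1ℚ - b)) * (1ℚ - a) * (1ℚ - 0ℚ)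
    same = solve-∀ ring
  cases (no x≢y) (no v≢y) _ rewrite eq-no x≢y | eq-no v≢y | eq-no (x≢y ∘ sym) | eq-sym x d =
    same (eq v d) (eq d x) (eq d v) (eq v x) K
    where
    same : ∀ a b c e K → (1ℚ - a) * ((1ℚ - b) * ((1ℚ - 0ℚ) * K)) - (1ℚ - c) * (0ℚ * (K * (1ℚ - 0ℚ)))
      + b * (0ℚ * 1ℚ * K) - c * (e * (0ℚ * K)) ≡ (1ℚ - 0ℚ) * (K * (1ℚ - b)) * (1ℚ - a) * (1ℚ - 0ℚ)
    same = solve-∀ ring

-- Colour functions of lists of blocks

ColourFn : Set → Set
ColourFn V = (V → ℕ) → ℚ

Block : Set → Set
Block V = V × List V

module _ {V : Set} where

  elements : Block V → List V
  elements (v , B) = v ∷ B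

  support : List (Block V) → List V
  support = concatMap elements

  size : Block V → ℕ
  size (_ , B) = length B

  avoids coincides : (V → ℕ) → ℕ → List V → ℚ
  avoids    w c []       = 1ℚ
  avoids    w c (u ∷ us) = ne c (w u) * avoids w c us
  coincides w c []       = 1ℚ
  coincides w c (u ∷ us) = eq c (w u) * coincides w c us

  distinct : (V → ℕ) → List V → ℚ
  distinct w []       = 1ℚ
  distinct w (u ∷ us) = avoids w (w u) us * distinct w us

  family : (V → ℕ) → List (Block V) → ℚ
  family w []       = 1ℚ
  family w (C ∷ Cs) = distinct w (elements C) * family w Cs

  avoids-↭ : ∀ w c {us vs} → us ↭ vs → avoids w c us ≡ avoids w c vs
  avoids-↭ w c ↭.refl                   = refl
  avoids-↭ w c (↭.prep u p)             = cong (ne c (w u) *_) (avoids-↭ w c p)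
  avoids-↭ w c (↭.swap {xs = us} u v p) =
    trans (swap-factors (ne c (w u)) (ne c (w v)) (avoids w c us))
      (cong (λ r → ne c (w v) * (ne c (w u) * r)) (avoids-↭ w c p))
  avoids-↭ w c (↭.trans p q)            = trans (avoids-↭ w c p) (avoids-↭ w c q)

  coincides-↭ : ∀ w c {us vs} → us ↭ vs → coincides w c us ≡ coincides w c vs
  coincides-↭ w c ↭.refl                   = refl
  coincides-↭ w c (↭.prep u p)             = cong (eq c (w u) *_) (coincides-↭ w c p)
  coincides-↭ w c (↭.swap {xs = us} u v p) =
    trans (swap-factors (eq c (w u)) (eq c (w v)) (coincides w c us))
      (cong (λ r → eq c (w v) * (eq c (w u) * r)) (coincides-↭ w c p))
  coincides-↭ w c (↭.trans p q)            = trans (coincides-↭ w c p) (coincides-↭ w c q)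

  avoids-idem : ∀ w c us → avoids w c us * avoids w c us ≡ avoids w c us
  avoids-idem w c []       = refl
  avoids-idem w c (u ∷ us) =
    trans (interchange (ne c (w u)) (avoids w c us)) (cong₂ _*_ (ne-idem c (w u)) (avoids-idem w c us))
    where
    interchange : ∀ a b → a * b * (a * b) ≡ a * a * (b * b)
    interchange = solve-∀ ring

  -- Among vertices of pairwise distinct colours at most one has colour `c`, so summing over the
  -- vertex that has it gives exactly the colourings in which `c` is not avoided.
  distinct-picks : ∀ w c us →
    ∑ (λ (v , vs) → eq c (w v) * (avoids w c vs * distinct w vs)) (picks us)
    ≡ distinct w us - avoids w c us * distinct w us
  distinct-picks w c []       = refl
  distinct-picks w c (u ∷ us) = begin
    eq c (w u) * (av c * d) + ∑ t (map (map₂ (u ∷_)) (picks us))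
      ≡⟨ cong (eq c (w u) * (av c * d) +_) (∑-map t (map₂ (u ∷_)) (picks us)) ⟩
    eq c (w u) * (av c * d) + ∑ (t ∘ map₂ (u ∷_)) (picks us)
      ≡⟨ cong (eq c (w u) * (av c * d) +_) (∑-cong-All (All.map (λ {p} → term p) (picks-↭ us))) ⟩
    eq c (w u) * (av c * d) + ∑ (λ p → av (w u) * t p) (picks us)
      ≡⟨ cong (eq c (w u) * (av c * d) +_) (trans (∑-* (av (w u)) t (picks us)) (cong (av (w u) *_) (distinct-picks w c us))) ⟩
    eq c (w u) * (av c * d) + av (w u) * (d - av c * d)
      ≡⟨ final ⟩
    av (w u) * d - (ne c (w u) * av c) * (av (w u) * d) ∎
    where
    open ≡-Reasoning
    d = distinct w us
    av : ℕ → ℚ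
    av c = avoids w c us
    t : Block V → ℚ
    t (v , vs) = eq c (w v) * (avoids w c vs * distinct w vs)
    term : ∀ ((v , vs) : Block V) → v ∷ vs ↭ us → t (v , u ∷ vs) ≡ av (w u) * t (v , vs)
    term (v , vs) p = begin
      eq c (w v) * (ne c (w u) * avoids w c vs * (avoids w (w u) vs * distinct w vs))
        ≡⟨ eq-subst (λ k → ne k (w u) * avoids w c vs * (avoids w (w u) vs * distinct w vs)) c (w v) ⟩
      eq c (w v) * (ne (w v) (w u) * avoids w c vs * (avoids w (w u) vs * distinct w vs))
        ≡⟨ cong (λ r → eq c (w v) * (r * avoids w c vs * (avoids w (w u) vs * distinct w vs))) (ne-sym (w v) (w u)) ⟩
      eq c (w v) * (ne (w u) (w v) * avoids w c vs * (avoids w (w u) vs * distinct w vs))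
        ≡⟨ regroup (eq c (w v)) (ne (w u) (w v)) (avoids w c vs) (avoids w (w u) vs) (distinct w vs) ⟩
      ne (w u) (w v) * avoids w (w u) vs * t (v , vs)
        ≡⟨ cong (_* t (v , vs)) (avoids-↭ w (w u) p) ⟩
      av (w u) * t (v , vs) ∎
      where
      regroup : ∀ a b c d e → a * (b * c * (d * e)) ≡ b * d * (a * (c * e))
      regroup = solve-∀ ring
    final : eq c (w u) * (av c * d) + av (w u) * (d - av c * d) ≡ av (w u) * d - (ne c (w u) * av c) * (av (w u) * d)
    final = begin
      eq c (w u) * (av c * d) + av (w u) * (d - av c * d)
        ≡⟨ lhs (eq c (w u)) (av c) (av (w u)) d ⟩
      eq c (w u) * av c * d + av (w u) * (d - av c * d)
        ≡⟨ cong (λ r → r * d + av (w u) * (d - av c * d)) absorb ⟩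
      eq c (w u) * (av c * av (w u)) * d + av (w u) * (d - av c * d)
        ≡⟨ rhs (eq c (w u)) (av c) (av (w u)) d ⟩
      av (w u) * d - (ne c (w u) * av c) * (av (w u) * d) ∎
      where
      lhs : ∀ e a b d → e * (a * d) + b * (d - a * d) ≡ e * a * d + b * (d - a * d)
      lhs = solve-∀ ring
      rhs : ∀ e a b d → e * (a * b) * d + b * (d - a * d) ≡ b * d - ((1ℚ - e) * a) * (b * d)
      rhs = solve-∀ ring
      absorb : eq c (w u) * av c ≡ eq c (w u) * (av c * av (w u))
      absorb = trans (cong (eq c (w u) *_) (sym (avoids-idem w c us)))
                       (eq-subst (λ k → av c * av k) c (w u))

  -- Expansions relative to a pointed vertex

  -- f is a linear combination of functions e_σ of set partitions σ of vs, given as lists of blocks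
  -- whose first block contains the pointed vertex z; Φ records the sizes and the coefficients.
  -- The normalisation by weight gives U, A and P integer coefficients.
  data Expansion (z : V) (vs : List V) : ColourFn V → Functional → Set where
    blocks : ∀ B Cs → z ∷ B ++ support Cs ↭ vs →
             Expansion z vs (λ w → family w ((z , B) ∷ Cs))
                            (λ ψ → weight (length B) (map size Cs) * ψ (length B) (map size Cs))
    none   : Expansion z vs (λ _ → 0ℚ) (λ _ → 0ℚ)
    plus   : ∀ {f g Φ Ψ} → Expansion z vs f Φ → Expansion z vs g Ψ →
             Expansion z vs (λ w → f w + g w) (λ ψ → Φ ψ + Ψ ψ)
    scale  : ∀ {f Φ} a → Expansion z vs f Φ → Expansion z vs (λ w → a * f w) (λ ψ → a * Φ ψ)
    transport   : ∀ {f g Φ Ψ} → (∀ w → f w ≡ g w) → (∀ ψ → Φ ψ ≡ Ψ ψ) → Expansion z vs f Φ → Expansion z vs g Ψ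

  minus : ∀ {z vs f g Φ Ψ} → Expansion z vs f Φ → Expansion z vs g Ψ →
          Expansion z vs (λ w → f w - g w) (λ ψ → Φ ψ - Ψ ψ)
  minus {f = f} {g} {Φ} {Ψ} E E′ =
    transport (λ w → neg (f w) (g w)) (λ ψ → neg (Φ ψ) (Ψ ψ)) (plus E (scale (- 1ℚ) E′))
    where
    neg : ∀ a b → a + - 1ℚ * b ≡ a - b
    neg = solve-∀ ring

  sums : ∀ {X : Set} {z vs Φ} {f : X → ColourFn V} {xs} → All (λ x → Expansion z vs (f x) Φ) xs →
         Expansion z vs (λ w → ∑ (λ x → f x w) xs) (λ ψ → ι (length xs) * Φ ψ)
  sums {Φ = Φ} []                 = transport (λ _ → refl) (λ ψ → sym (ℚ.*-zeroˡ (Φ ψ))) none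
  sums {Φ = Φ} {xs = x ∷ xs} (E ∷ Es) =
    transport (λ _ → refl) (λ ψ → factor (Φ ψ) (ι (length xs))) (plus E (sums Es))
    where
    factor : ∀ a n → a + n * a ≡ (1ℚ + n) * a
    factor = solve-∀ ring

  Expansion-↭ : ∀ {z us vs f Φ} → us ↭ vs → Expansion z us f Φ → Expansion z vs f Φ
  Expansion-↭ p (blocks B Cs q) = blocks B Cs (↭-trans q p)
  Expansion-↭ p none            = none
  Expansion-↭ p (plus E E′)     = plus (Expansion-↭ p E) (Expansion-↭ p E′)
  Expansion-↭ p (scale a E)     = scale a (Expansion-↭ p E)
  Expansion-↭ p (transport eq eq′ E) = transport eq eq′ (Expansion-↭ p E)

  -- By linearity a single family suffices. The functional is precomposed with `T`, so the vertex
  -- attached last contributes the operator applied first to `ψ`.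
  lift : ∀ {v vs z us} (g : ColourFn V) (T : Weighting → Weighting) →
    (∀ B Cs → v ∷ B ++ support Cs ↭ vs →
      Expansion z us (λ w → g w * family w ((v , B) ∷ Cs))
                     (λ ψ → weight (length B) (map size Cs) * T ψ (length B) (map size Cs))) →
    ∀ {f Φ} → Expansion v vs f Φ → Expansion z us (λ w → g w * f w) (Φ ∘ T)
  lift g T base (blocks B Cs p)      = base B Cs p
  lift g T base none                 = transport (λ w → sym (ℚ.*-zeroʳ (g w))) (λ _ → refl) none
  lift g T base (plus {f} {f′} E E′) =
    transport (λ w → sym (ℚ.*-distribˡ-+ (g w) (f w) (f′ w))) (λ _ → refl) (plus (lift g T base E) (lift g T base E′))
  lift g T base (scale {f} a E)      =
    transport (λ w → swap-factors a (g w) (f w)) (λ _ → refl) (scale a (lift g T base E))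
  lift g T base (transport eq eq′ E) =
    transport (λ w → cong (g w *_) (eq w)) (eq′ ∘ T) (lift g T base E)

  -- Colour coincidences in the e-basis

  coinciding : V → List V → List (Block V) → ColourFn V
  coinciding z S Cs w = coincides w (w z) S * family w Cs

  -- Interpolates between the e-function of `(z , B) ∷ Cs`, for empty `S`, and a power sum on
  -- `z ∷ S` times the e-function of `Cs`, for empty `B`. With `S = v ∷ []` it is the product of
  -- [w_z = w_v] and the e-function of `(v , B) ∷ Cs`.
  attached : V → List V → List V → List (Block V) → ColourFn V
  attached z B S Cs w = coincides w (w z) S * (avoids w (w z) B * distinct w B * family w Cs)

  attached-picks : ∀ z v B S Cs w →
    attached z (v ∷ B) S Cs w ≡ coinciding z S ((v , B) ∷ Cs) w - ∑ (λ (u , us) → attached z us (u ∷ S) Cs w) (picks (v ∷ B))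
  attached-picks z v B S Cs w = begin
    co * (av * d * fam)
      ≡⟨ lhs co av d fam ⟩
    co * (d * fam) - co * fam * (d - av * d)
      ≡⟨ cong (λ r → co * (d * fam) - co * fam * r) (sym (distinct-picks w c (v ∷ B))) ⟩
    co * (d * fam) - co * fam * ∑ t (picks (v ∷ B))
      ≡⟨ cong (λ r → co * (d * fam) - r) (sym (∑-* (co * fam) t (picks (v ∷ B)))) ⟩
    co * (d * fam) - ∑ (λ p → co * fam * t p) (picks (v ∷ B))
      ≡⟨ cong (λ r → co * (d * fam) - r) (∑-cong term (picks (v ∷ B))) ⟩
    co * (d * fam) - ∑ (λ (u , us) → attached z us (u ∷ S) Cs w) (picks (v ∷ B)) ∎
    where
    open ≡-Reasoning
    c   = w z
    co  = coincides w c S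
    av  = avoids w c (v ∷ B)
    d   = distinct w (v ∷ B)
    fam = family w Cs
    t : Block V → ℚ
    t (u , us) = eq c (w u) * (avoids w c us * distinct w us)
    lhs : ∀ a b d f → a * (b * d * f) ≡ a * (d * f) - a * f * (d - b * d)
    lhs = solve-∀ ring
    term : ∀ ((u , us) : Block V) → co * fam * t (u , us) ≡ attached z us (u ∷ S) Cs w
    term (u , us) = regroup co fam (eq c (w u)) (avoids w c us) (distinct w us)
      where
      regroup : ∀ a f e b d → a * f * (e * (b * d)) ≡ e * a * (b * d * f)
      regroup = solve-∀ ring

  -- Iterating attached-picks moves all of B into S, in |B|! orders and with sign (-1)^|B|.
  defect : V → List V → List V → List (Block V) → ColourFn V
  defect z B S Cs w = attached z B S Cs w - signedFact (length B) * coinciding z (S ++ B) Cs w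

  -- The functional is asserted to depend on the sizes of the blocks only.
  Coinciding-expandable : ℕ → List ℕ → Set
  Coinciding-expandable n λs = Σ[ Φ ∈ Functional ] ∀ z S Cs → length S ≡ n → map size Cs ≡ λs →
    Expansion z (z ∷ S ++ support Cs) (coinciding z S Cs) Φ

  Defect-expandable : ℕ → ℕ → List ℕ → Set
  Defect-expandable k n λs = Σ[ Φ ∈ Functional ] ∀ z B S Cs → length B ≡ k → length S ≡ n → map size Cs ≡ λs →
    Expansion z (z ∷ S ++ B ++ support Cs) (defect z B S Cs) Φ

  -- Whichever element of `v ∷ B` is moved, the final coincidence set is the same up to order. The
  -- main terms therefore add up to `ι (suc (length B))` equal ones, matching the recursion of
  -- `signedFact`.
  defect-picks : ∀ z v B S Cs w →
    coinciding z S ((v , B) ∷ Cs) w - ∑ (λ (u , us) → defect z us (u ∷ S) Cs w) (picks (v ∷ B)) ≡ defect z (v ∷ B) S Cs w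
  defect-picks z v B S Cs w = begin
    p - ∑ x ps
      ≡⟨ rhs p (∑ x ps) (ι (length (v ∷ B))) (signedFact (length B)) q ⟩
    p - (∑ x ps + ι (length (v ∷ B)) * (signedFact (length B) * q)) - signedFact (length (v ∷ B)) * q
      ≡⟨ cong (λ r → p - r - signedFact (length (v ∷ B)) * q) (sym total) ⟩
    p - ∑ r ps - signedFact (length (v ∷ B)) * q
      ≡⟨ cong (_- signedFact (length (v ∷ B)) * q) (sym (attached-picks z v B S Cs w)) ⟩
    defect z (v ∷ B) S Cs w ∎
    where
    open ≡-Reasoning
    ps = picks (v ∷ B)
    p  = coinciding z S ((v , B) ∷ Cs) w
    q  = coinciding z (S ++ v ∷ B) Cs w
    x r : Block V → ℚ
    x (u , us) = defect z us (u ∷ S) Cs w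
    r (u , us) = attached z us (u ∷ S) Cs w
    rhs : ∀ p s n c q → p - s ≡ p - (s + n * (c * q)) - (- (n * c)) * q
    rhs = solve-∀ ring
    split : ∀ ((u , us) : Block V) → u ∷ us ↭ v ∷ B → r (u , us) ≡ x (u , us) + signedFact (length B) * q
    split (u , us) perm = trans (add-back (r (u , us)) (signedFact (length us) * coinciding z (u ∷ S ++ us) Cs w))
      (cong₂ (λ l m → x (u , us) + signedFact l * (m * family w Cs)) (ℕ.suc-injective (↭-length perm))
        (coincides-↭ w (w z) (↭-trans (↭-sym (shift u S us)) (++⁺ˡ S perm))))
      where
      add-back : ∀ a b → a ≡ a - b + b
      add-back = solve-∀ ring
    total : ∑ r ps ≡ ∑ x ps + ι (length (v ∷ B)) * (signedFact (length B) * q)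
    total = begin
      ∑ r ps
        ≡⟨ ∑-cong-All (All.map (λ {t} → split t) (picks-↭ (v ∷ B))) ⟩
      ∑ (λ t → x t + signedFact (length B) * q) ps
        ≡⟨ ∑-+ x (λ _ → signedFact (length B) * q) ps ⟩
      ∑ x ps + ∑ (λ _ → signedFact (length B) * q) ps
        ≡⟨ cong (∑ x ps +_) (trans (∑-const (signedFact (length B) * q) ps)
             (cong (λ n → ι n * (signedFact (length B) * q)) (length-picks (v ∷ B)))) ⟩
      ∑ x ps + ι (length (v ∷ B)) * (signedFact (length B) * q) ∎

  -- The subtracted term is the only one with all `k ℕ.+ n` coincidences. The others have fewer and
  -- are covered by `rec`.
  defect-expandable : ∀ k n λs → (∀ {m} → m ℕ.< k ℕ.+ n → ∀ μs → Coinciding-expandable m μs) → Defect-expandable k n λs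
  defect-expandable zero n λs rec = (λ _ → 0ℚ) , λ {
    z [] S Cs _ _ _ → transport (vanish z S Cs) (λ _ → refl) none }
    where
    vanish : ∀ z S Cs w → 0ℚ ≡ defect z [] S Cs w
    vanish z S Cs w rewrite ++-identityʳ S = cancel (coincides w (w z) S) (family w Cs)
      where
      cancel : ∀ a f → 0ℚ ≡ a * (1ℚ * 1ℚ * f) - 1ℚ * (a * f)
      cancel = solve-∀ ring
  defect-expandable (suc k) n λs rec = (λ ψ → Φ ψ - ι (suc k) * Ψ ψ) , λ {
    z (v ∷ B) S Cs refl refl refl →
      transport (defect-picks z v B S Cs) (λ ψ → cong (λ l → Φ ψ - ι l * Ψ ψ) (length-picks (v ∷ B)))
        (minus (expΦ z S ((v , B) ∷ Cs) refl refl)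
          (sums (All.map (λ {(u , us)} p →
              Expansion-↭ (rearrange z u us v B S Cs p)
                (expΨ z us (u ∷ S) Cs (ℕ.suc-injective (↭-length p)) refl refl))
            (picks-↭ (v ∷ B))))) }
    where
    Φ-exp = rec {n} (s≤s (ℕ.m≤n+m n k)) (k ∷ λs)
    Φ = proj₁ Φ-exp
    expΦ = proj₂ Φ-exp
    Ψ-exp = defect-expandable k (suc n) λs (λ m<k+1+n → rec (ℕ.≤-trans m<k+1+n (ℕ.≤-reflexive (ℕ.+-suc k n))))
    Ψ = proj₁ Ψ-exp
    expΨ = proj₂ Ψ-exp
    rearrange : ∀ z u us v B S Cs → u ∷ us ↭ v ∷ B →
      z ∷ (u ∷ S) ++ us ++ support Cs ↭ z ∷ S ++ support ((v , B) ∷ Cs)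
    rearrange z u us v B S Cs p =
      ↭.prep z (↭-trans (↭-sym (shift u S (us ++ support Cs))) (++⁺ˡ S (++⁺ʳ (support Cs) p)))

  -- Triangularity: the e-function of `(z , S) ∷ Cs` is `signedFact n` times the wanted function
  -- plus a defect with smaller coincidence sets, and that coefficient is invertible.
  coinciding-expandable : ∀ n λs → Coinciding-expandable n λs
  coinciding-expandable = <-rec (λ n → ∀ λs → Coinciding-expandable n λs) λ n rec λs →
    let Φ , expΦ = defect-expandable n 0 λs (λ m<n+0 → rec (ℕ.≤-trans m<n+0 (ℕ.≤-reflexive (ℕ.+-identityʳ n))))
    in (λ ψ → signedRecip n * (weight n λs * ψ n λs - Φ ψ)) , λ {
      z S Cs refl refl →
        transport (isolate z S Cs) (λ _ → refl)
          (scale (signedRecip n) (minus (blocks S Cs ↭-refl) (expΦ z S [] Cs refl refl refl))) }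
    where
    isolate : ∀ z S Cs w →
      signedRecip (length S) * (family w ((z , S) ∷ Cs) - defect z S [] Cs w) ≡ coinciding z S Cs w
    isolate z S Cs w = begin
      signedRecip (length S) * (avoids w (w z) S * distinct w S * family w Cs - defect z S [] Cs w)
        ≡⟨ cancel (signedRecip (length S)) (avoids w (w z) S * distinct w S * family w Cs) (signedFact (length S)) (coinciding z S Cs w) ⟩
      signedRecip (length S) * signedFact (length S) * coinciding z S Cs w
        ≡⟨ cong (_* coinciding z S Cs w) (signedFact-inverse (length S)) ⟩
      1ℚ * coinciding z S Cs w
        ≡⟨ ℚ.*-identityˡ (coinciding z S Cs w) ⟩
      coinciding z S Cs w ∎
      where
      open ≡-Reasoning
      cancel : ∀ i e c p → i * (e - (1ℚ * e - c * p)) ≡ i * c * p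
      cancel = solve-∀ ring

  -- The point is that one `Φ` serves every `v` and `B` of the given sizes; its value is left open.
  attached-expandable : ∀ b λs → Σ[ Φ ∈ Functional ] ∀ z v B Cs → length B ≡ b → map size Cs ≡ λs →
    Expansion z (z ∷ v ∷ B ++ support Cs) (attached z B (v ∷ []) Cs) Φ
  attached-expandable b λs =
    let Φ , expΦ = defect-expandable b 1 λs (λ {m} _ → coinciding-expandable m)
        Ψ , expΨ = coinciding-expandable (suc b) λs
    in (λ ψ → Φ ψ + signedFact b * Ψ ψ) , λ {
      z v B Cs refl refl →
        transport (λ w → add-back (attached z B (v ∷ []) Cs w) (signedFact b * coinciding z (v ∷ B) Cs w)) (λ _ → refl)
          (plus (expΦ z B (v ∷ []) Cs refl refl refl) (scale (signedFact b) (expΨ z (v ∷ B) Cs refl refl))) }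
    where
    add-back : ∀ a b → a - b + b ≡ a
    add-back = solve-∀ ring

  -- The |B| + 1 ways to choose the vertex of v ∷ B whose colour z shares have expansions with the
  -- same functional, so that functional can be found by averaging.
  attached-expansion : ∀ z v B Cs → Expansion z (z ∷ v ∷ B ++ support Cs) (attached z B (v ∷ []) Cs)
    (λ ψ → weight (length B) (map size Cs) * U ψ (length B) (map size Cs))
  attached-expansion z v B Cs =
    transport average functional $ scale (recip b) $
      plus (minus (blocks [] ((v , B) ∷ Cs) ↭-refl) (blocks (v ∷ B) Cs ↭-refl))
           -- Each summand exchanges the choice `u` for `v`. It changes the function but contributes
           -- `Φ ψ - Φ ψ` to the functional.
           (sums (All.map (λ {(u , us)} p → minus (exp z v B Cs refl refl)
              (Expansion-↭ (↭.prep z (++⁺ʳ (support Cs) p))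
                (exp z u us Cs (ℕ.suc-injective (↭-length p)) refl)))
            (picks-↭ (v ∷ B))))
    where
    b  = length B
    λs = map size Cs
    ps = picks (v ∷ B)
    Φ  = proj₁ (attached-expandable b λs)
    exp = proj₂ (attached-expandable b λs)
    average : ∀ w →
      recip b * (family w ((z , []) ∷ (v , B) ∷ Cs) - family w ((z , v ∷ B) ∷ Cs)
        + ∑ (λ (u , us) → attached z B (v ∷ []) Cs w - attached z us (u ∷ []) Cs w) ps) ≡ attached z B (v ∷ []) Cs w
    average w = begin
      recip b * (1ℚ * 1ℚ * p - av * d * fam + ∑ (λ t → ρ - r t) ps)
        ≡⟨ cong (λ s → recip b * (1ℚ * 1ℚ * p - av * d * fam + s)) total ⟩
      recip b * (1ℚ * 1ℚ * p - av * d * fam + (ι (suc b) * ρ - (1ℚ * p - 1ℚ * (av * d * fam))))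
        ≡⟨ collect (recip b) (ι (suc b)) ρ p (av * d * fam) ⟩
      recip b * ι (suc b) * ρ
        ≡⟨ cong (_* ρ) (recip-inverse b) ⟩
      1ℚ * ρ
        ≡⟨ ℚ.*-identityˡ ρ ⟩
      ρ ∎
      where
      open ≡-Reasoning
      p   = family w ((v , B) ∷ Cs)
      av  = avoids w (w z) (v ∷ B)
      d   = distinct w (v ∷ B)
      fam = family w Cs
      ρ   = attached z B (v ∷ []) Cs w
      r : Block V → ℚ
      r (u , us) = attached z us (u ∷ []) Cs w
      collect : ∀ i n ρ p q → i * (1ℚ * 1ℚ * p - q + (n * ρ - (1ℚ * p - 1ℚ * q))) ≡ i * n * ρ
      collect = solve-∀ ring
      Σr : ∑ r ps ≡ 1ℚ * p - 1ℚ * (av * d * fam)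
      Σr = trans (flip′ (1ℚ * p) (∑ r ps)) (cong (λ s → 1ℚ * p - s) (sym (attached-picks z v B [] Cs w)))
        where
        flip′ : ∀ a s → s ≡ a - (a - s)
        flip′ = solve-∀ ring
      total : ∑ (λ t → ρ - r t) ps ≡ ι (suc b) * ρ - (1ℚ * p - 1ℚ * (av * d * fam))
      total = begin
        ∑ (λ t → ρ - r t) ps
          ≡⟨ ∑-cong (λ t → as-sum ρ (r t)) ps ⟩
        ∑ (λ t → ρ + - 1ℚ * r t) ps
          ≡⟨ ∑-+ (λ _ → ρ) (λ t → - 1ℚ * r t) ps ⟩
        ∑ (λ _ → ρ) ps + ∑ (λ t → - 1ℚ * r t) ps
          ≡⟨ cong₂ _+_ (trans (∑-const ρ ps) (cong (λ n → ι n * ρ) (length-picks (v ∷ B)))) (∑-* (- 1ℚ) r ps) ⟩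
        ι (suc b) * ρ + - 1ℚ * ∑ r ps
          ≡⟨ sym (as-sum (ι (suc b) * ρ) (∑ r ps)) ⟩
        ι (suc b) * ρ - ∑ r ps
          ≡⟨ cong (λ s → ι (suc b) * ρ - s) Σr ⟩
        ι (suc b) * ρ - (1ℚ * p - 1ℚ * (av * d * fam)) ∎
        where
        as-sum : ∀ a b → a - b ≡ a + - 1ℚ * b
        as-sum = solve-∀ ring
    functional : ∀ ψ →
      recip b * (weight 0 (b ∷ λs) * ψ 0 (b ∷ λs) - weight (suc b) λs * ψ (suc b) λs
        + ι (length ps) * (Φ ψ - Φ ψ)) ≡ weight b λs * U ψ b λs
    functional ψ =
      trans (collect (recip b) (ι (suc b)) (fact b) (facts λs) (ψ 0 (b ∷ λs)) (ψ (suc b) λs) (ι (length ps)) (Φ ψ))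
        (trans (cong (_* (weight b λs * U ψ b λs)) (recip-inverse b)) (ℚ.*-identityˡ _))
      where
      collect : ∀ i n f fs x y l φ →
        i * (1ℚ * (n * f * fs) * x - n * f * fs * y + l * (φ - φ)) ≡ i * n * (f * fs * (x - y))
      collect = solve-∀ ring

  -- Attaching one vertex to the pointed vertex

  -- The factor b + 1 appears because the old block is no longer pointed, so its weight rises from
  -- b! to (b+1)!.
  lone-last : ∀ {z v : V} {vs f Φ} → Expansion v vs f Φ →
              Expansion z (z ∷ vs) f (λ ψ → Φ (λ b λs → ι (suc b) * ψ 0 (b ∷ λs)))
  lone-last {z} {v} {vs} {f} E =
    transport (λ w → ℚ.*-identityˡ (f w)) (λ _ → refl)
      (lift (λ _ → 1ℚ) (λ ψ b λs → ι (suc b) * ψ 0 (b ∷ λs)) (λ B Cs p →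
        transport (λ w → units (family w ((v , B) ∷ Cs)))
                  (λ ψ → reassociate (ι (suc (length B))) (fact (length B)) (facts (map size Cs))
                                     (ψ 0 (length B ∷ map size Cs)))
          (blocks [] ((v , B) ∷ Cs) (↭.prep z p))) E)
    where
    units : ∀ a → 1ℚ * 1ℚ * a ≡ 1ℚ * a
    units = solve-∀ ring
    reassociate : ∀ n f fs x → 1ℚ * (n * f * fs) * x ≡ f * fs * (n * x)
    reassociate = solve-∀ ring

  lone : ∀ {z v : V} {vs f Φ} → Expansion v vs f Φ → Expansion v (z ∷ vs) f (λ ψ → Φ (ε 0 ψ))
  lone {z} {v} {vs} {f} E =
    transport (λ w → ℚ.*-identityˡ (f w)) (λ _ → refl)
      (lift (λ _ → 1ℚ) (ε 0) (λ B Cs p →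
        transport (λ w → units (distinct w (v ∷ B)) (family w Cs))
                  (λ ψ → reassociate (fact (length B)) (facts (map size Cs)) (ψ (length B) (0 ∷ map size Cs)))
          (blocks B ((z , []) ∷ Cs) (↭-trans (shift z (v ∷ B) (support Cs)) (↭.prep z p)))) E)
    where
    units : ∀ a b → a * (1ℚ * 1ℚ * b) ≡ 1ℚ * (a * b)
    units = solve-∀ ring
    reassociate : ∀ f fs x → f * ((1ℚ + 0ℚ) * 1ℚ * fs) * x ≡ f * fs * x
    reassociate = solve-∀ ring

  equal-last : ∀ {z v vs f Φ} → Expansion v vs f Φ →
               Expansion z (z ∷ vs) (λ w → eq (w z) (w v) * f w) (Φ ∘ U)
  equal-last {z} {v} {vs} = lift (λ w → eq (w z) (w v)) U λ B Cs p →
    transport (same B Cs) (λ _ → refl) (Expansion-↭ (↭.prep z p) (attached-expansion z v B Cs))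
    where
    same : ∀ B Cs w → attached z B (v ∷ []) Cs w ≡ eq (w z) (w v) * family w ((v , B) ∷ Cs)
    same B Cs w = trans (cong (_* (avoids w (w z) B * distinct w B * family w Cs)) (ℚ.*-identityʳ (eq (w z) (w v))))
                        (eq-subst (λ k → avoids w k B * distinct w B * family w Cs) (w z) (w v))

  -- Same operator as for `equal-last`: equality of colours is symmetric, so `z` can take the place
  -- of `v` in the block and `v` that of the new vertex.
  equal : ∀ {z v vs f Φ} → Expansion v vs f Φ →
          Expansion v (z ∷ vs) (λ w → eq (w z) (w v) * f w) (Φ ∘ U)
  equal {z} {v} {vs} = lift (λ w → eq (w z) (w v)) U λ B Cs p →
    transport (same B Cs) (λ _ → refl)
      (Expansion-↭ (↭-trans (↭.swap v z ↭-refl) (↭.prep z p)) (attached-expansion v z B Cs))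
    where
    same : ∀ B Cs w → attached v B (z ∷ []) Cs w ≡ eq (w z) (w v) * family w ((v , B) ∷ Cs)
    same B Cs w = cong (_* family w ((v , B) ∷ Cs)) (trans (ℚ.*-identityʳ (eq (w v) (w z))) (eq-sym (w v) (w z)))

  unequal-last : ∀ {z v : V} {vs f Φ} → Expansion v vs f Φ →
                 Expansion z (z ∷ vs) (λ w → ne (w z) (w v) * f w) (Φ ∘ A)
  unequal-last {z} {v} {vs} = lift (λ w → ne (w z) (w v)) A λ B Cs p →
    transport (λ w → complement (eq (w z) (w v)) (family w ((v , B) ∷ Cs)))
              (λ ψ → collect (weight (length B) (map size Cs)) (ι (length B)) (ψ 0 (length B ∷ map size Cs))
                             (ψ (suc (length B)) (map size Cs)))
      (minus (lone-last (blocks B Cs p)) (equal-last (blocks B Cs p)))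
    where
    complement : ∀ e a → a - e * a ≡ (1ℚ - e) * a
    complement = solve-∀ ring
    collect : ∀ f n x y → f * ((1ℚ + n) * x) - f * (x - y) ≡ f * (n * x + y)
    collect = solve-∀ ring

  unequal : ∀ {z v : V} {vs f Φ} → Expansion v vs f Φ →
            Expansion v (z ∷ vs) (λ w → ne (w z) (w v) * f w) (Φ ∘ P)
  unequal {z} {v} {vs} = lift (λ w → ne (w z) (w v)) P λ B Cs p →
    transport (λ w → complement (eq (w z) (w v)) (family w ((v , B) ∷ Cs)))
              (λ ψ → factor (weight (length B) (map size Cs)) (ε 0 ψ (length B) (map size Cs))
                            (U ψ (length B) (map size Cs)))
      (minus (lone (blocks B Cs p)) (equal (blocks B Cs p)))
    where
    complement : ∀ e a → a - e * a ≡ (1ℚ - e) * a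
    complement = solve-∀ ring
    factor : ∀ f x y → f * x - f * y ≡ f * (x - y)
    factor = solve-∀ ring

  -- Paths, cycles and the chorded cycle

  point : ∀ (v : V) → Expansion v (v ∷ []) (λ _ → 1ℚ) (λ ψ → ψ 0 [])
  point v = transport (λ _ → refl) (λ ψ → ℚ.*-identityˡ (ψ 0 [])) (blocks [] [] ↭-refl)

  path-expansion : ∀ {v vs f Φ} (us : List V) z → Expansion v vs f Φ →
    Expansion z (us ++ z ∷ vs) (λ w → f w * path (w v ∷ map w us ++ w z ∷ [])) (Φ ∘ A^ (suc (length us)))
  path-expansion {v} {vs} {f} [] z E =
    transport (λ w → trans (cong (_* f w) (ne-sym (w z) (w v))) (reorder (ne (w v) (w z)) (f w))) (λ _ → refl)
      (unequal-last E)
    where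
    reorder : ∀ p q → p * q ≡ q * (p * 1ℚ)
    reorder = solve-∀ ring
  path-expansion {v} {vs} {f} (u ∷ us) z E =
    Expansion-↭ (↭-trans (++⁺ˡ us (↭.swap z u ↭-refl)) (shift u us (z ∷ vs)))
      (transport (λ w → trans (cong (λ r → r * f w * path (w u ∷ map w us ++ w z ∷ [])) (ne-sym (w u) (w v)))
                              (reorder (ne (w v) (w u)) (f w) (path (w u ∷ map w us ++ w z ∷ []))))
                 (λ _ → refl)
        (path-expansion us z (unequal-last {z = u} E)))
    where
    reorder : ∀ p q r → p * q * r ≡ q * (p * r)
    reorder = solve-∀ ring

  cycle-expansion : ∀ (a : V) us →
    Expansion a (a ∷ us) (λ w → path (w a ∷ map w us ++ w a ∷ [])) (F (length us))
  -- A cycle on one vertex is a loop, without proper colourings; hence the value of `F zero`.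
  cycle-expansion a []       = transport (λ w → loop (w a)) (λ _ → refl) none
    where
    loop : ∀ c → 0ℚ ≡ ne c c * 1ℚ
    loop c rewrite eq-refl c = refl
  -- Deletion–contraction of the edge au.
  cycle-expansion a (u ∷ us) =
    transport delete-contract (λ _ → refl)
      (minus (Expansion-↭ (↭-trans (shift a us (u ∷ [])) (↭.prep a (↭-sym (∷↭∷ʳ u us))))
                (path-expansion us a (point u)))
             (equal-last (cycle-expansion u us)))
    where
    delete-contract : ∀ w → 1ℚ * path (w u ∷ map w us ++ w a ∷ []) - eq (w a) (w u) * path (w u ∷ map w us ++ w u ∷ [])
                          ≡ ne (w a) (w u) * path (w u ∷ map w us ++ w a ∷ [])
    delete-contract w =
      trans (cong (λ r → 1ℚ * path (w u ∷ map w us ++ w a ∷ []) - r)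
               (sym (eq-subst (λ k → path (w u ∷ map w us ++ k ∷ [])) (w a) (w u))))
            (collect (path (w u ∷ map w us ++ w a ∷ [])) (eq (w a) (w u)))
      where
      collect : ∀ p e → 1ℚ * p - e * p ≡ (1ℚ - e) * p
      collect = solve-∀ ring

  -- Deleting the edge `vy` leaves the tail `x`, `d`, `v` on the long cycle (`T₁`). In the
  -- contraction `v = y`, deleting `dx` gives `T₂`. Contracting `dx` as well makes `dv` parallel to
  -- the chord `xy`; deleting this double edge leaves a path (`T₃`), contracting it leaves a shorter
  -- cycle (`T₄`). Every piece can be built at the pointed vertex so that `d` ends up pointed; in
  -- `T₃` this requires gluing `v` to `y` before the path leaves `y`.
  chordedCycle-expansion : ∀ (v y : V) us x d →
    Expansion d (v ∷ y ∷ us ++ x ∷ d ∷ [])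
      (λ w → path (w v ∷ map w (y ∷ us) ++ w x ∷ w d ∷ []) * ne (w v) (w d) * ne (w y) (w x))
      (λ ψ → F (suc (length us)) (A (P ψ)) - F (suc (length us)) (U (A ψ))
             + U (A^ (suc (length us)) (U ψ)) 0 [] - F (length us) (U (U (U ψ))))
  chordedCycle-expansion v y us x d =
    transport identity (λ _ → refl)
      (minus (plus (minus T₁ T₂) T₃) T₄)
    where
    K : ColourFn V
    K w = path (w y ∷ map w us ++ w x ∷ [])
    T₁ : Expansion d (v ∷ y ∷ us ++ x ∷ d ∷ [])
           (λ w → ne (w v) (w d) * (ne (w d) (w x) * (ne (w x) (w y) * K w)))
           (λ ψ → F (suc (length us)) (A (P ψ)))
    T₁ = Expansion-↭ (↭.prep v (↭-trans (++-comm (d ∷ x ∷ []) (y ∷ us)) (++⁺ˡ (y ∷ us) (↭.swap d x ↭-refl))))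
           (unequal {z = v} (unequal-last {z = d} (cycle-expansion x (y ∷ us))))
    T₂ : Expansion d (v ∷ y ∷ us ++ x ∷ d ∷ [])
           (λ w → ne (w d) (w v) * (eq (w v) (w y) * (K w * ne (w x) (w y))))
           (λ ψ → F (suc (length us)) (U (A ψ)))
    T₂ = Expansion-↭ (↭-trans (++-comm (d ∷ []) (v ∷ y ∷ us ++ x ∷ [])) (↭-reflexive (cong (λ l → v ∷ y ∷ l) (++-assoc us (x ∷ []) (d ∷ [])))))
           (transport
             (λ w → cong (λ r → ne (w d) (w v) * (eq (w v) (w y) * r))
               (trans (cong (λ l → path (w y ∷ l))
                        (trans (cong (_++ w y ∷ []) (map-++ w us (x ∷ []))) (++-assoc (map w us) (w x ∷ []) (w y ∷ []))))
                      (path-∷ʳ (w y) (map w us) (w x) (w y))))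
             (λ ψ → cong (λ n → F n (U (A ψ))) (trans (length-++ us) (ℕ.+-comm (length us) 1)))
             (unequal-last {z = d} (equal-last {z = v} (cycle-expansion y (us ++ x ∷ [])))))
    T₃ : Expansion d (v ∷ y ∷ us ++ x ∷ d ∷ [])
           (λ w → eq (w d) (w x) * (eq (w v) (w y) * 1ℚ * K w))
           (λ ψ → U (A^ (suc (length us)) (U ψ)) 0 [])
    T₃ = Expansion-↭ (↭-trans (++-comm (d ∷ us ++ x ∷ []) (v ∷ y ∷ [])) (↭.prep v (↭.prep y
             (↭-trans (++-comm (d ∷ []) (us ++ x ∷ [])) (↭-reflexive (++-assoc us (x ∷ []) (d ∷ [])))))))
           (Expansion-↭ (↭-reflexive (cong (d ∷_) (sym (++-assoc us (x ∷ []) (v ∷ y ∷ [])))))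
             (equal-last {z = d} (path-expansion us x (equal {z = v} (point y)))))
    T₄ : Expansion d (v ∷ y ∷ us ++ x ∷ d ∷ [])
           (λ w → eq (w d) (w v) * (eq (w v) (w x) * (eq (w x) (w y) * path (w y ∷ map w us ++ w y ∷ []))))
           (λ ψ → F (length us) (U (U (U ψ))))
    T₄ = Expansion-↭ (↭-trans (↭.swap d v ↭-refl) (↭.prep v
             (↭-trans (++-comm (d ∷ x ∷ []) (y ∷ us)) (++⁺ˡ (y ∷ us) (↭.swap d x ↭-refl)))))
           (equal-last {z = d} (equal-last {z = v} (equal-last {z = x} (cycle-expansion y us))))
    identity : ∀ w →
      ne (w v) (w d) * (ne (w d) (w x) * (ne (w x) (w y) * K w))
        - ne (w d) (w v) * (eq (w v) (w y) * (K w * ne (w x) (w y)))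
        + eq (w d) (w x) * (eq (w v) (w y) * 1ℚ * K w)
        - eq (w d) (w v) * (eq (w v) (w x) * (eq (w x) (w y) * path (w y ∷ map w us ++ w y ∷ [])))
      ≡ path (w v ∷ map w (y ∷ us) ++ w x ∷ w d ∷ []) * ne (w v) (w d) * ne (w y) (w x)
    identity w = trans
      (four-cycle (w v) (w d) (w x) (w y) (K w) (path (w y ∷ map w us ++ w y ∷ []))
        (eq-subst (λ k → path (w y ∷ map w us ++ k ∷ [])) (w x) (w y)))
      (cong (λ r → ne (w v) (w y) * r * ne (w v) (w d) * ne (w y) (w x))
        (sym (path-∷ʳ (w y) (map w us) (w x) (w d))))

-- From lists of blocks to set partitions

indicator-cong : ∀ {X X′ : Set} (x? : Dec X) (x′? : Dec X′) → (X → X′) → (X′ → X) → indicator x? ≡ indicator x′?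
indicator-cong x? x′? f g = cong (if_then 1ℚ else 0ℚ) (does-≡ (map′ f g x?) x′?)

if-∧ : ∀ a b → (if a ∧ b then 1ℚ else 0ℚ) ≡ (if a then 1ℚ else 0ℚ) * (if b then 1ℚ else 0ℚ)
if-∧ true  b = sym (ℚ.*-identityˡ (if b then 1ℚ else 0ℚ))
if-∧ false b = sym (ℚ.*-zeroˡ (if b then 1ℚ else 0ℚ))

if-not : ∀ a → (if not a then 1ℚ else 0ℚ) ≡ 1ℚ - (if a then 1ℚ else 0ℚ)
if-not true  = refl
if-not false = refl

ne-indicator : ∀ a b → ne a b ≡ indicator (¬? (a ℕ.≟ b))
ne-indicator a b = sym (if-not (does (a ℕ.≟ b)))

module _ {V : Set} where

  NoRepeats : (V → ℕ) → Block (V) → Set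
  NoRepeats w C = AllPairs (λ u v → w u ≢ w v) (elements C)

  avoids-indicator : ∀ (w : V → ℕ) c us → avoids w c us ≡ indicator (all? (λ u → ¬? (c ℕ.≟ w u)) us)
  avoids-indicator w c []       = refl
  avoids-indicator w c (u ∷ us) = trans (cong₂ _*_ (ne-indicator c (w u)) (avoids-indicator w c us))
    (sym (if-∧ (does (¬? (c ℕ.≟ w u))) (does (all? (λ u → ¬? (c ℕ.≟ w u)) us))))

  distinct-indicator : ∀ (w : V → ℕ) us → distinct w us ≡ indicator (allPairs? (λ u v → ¬? (w u ℕ.≟ w v)) us)
  distinct-indicator w []       = refl
  distinct-indicator w (u ∷ us) = trans (cong₂ _*_ (avoids-indicator w (w u) us) (distinct-indicator w us))
    (sym (if-∧ (does (all? (λ v → ¬? (w u ℕ.≟ w v)) us)) (does (allPairs? (λ u v → ¬? (w u ℕ.≟ w v)) us))))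

  family-indicator : ∀ (w : V → ℕ) Cs →
    family w Cs ≡ indicator (all? (λ C → allPairs? (λ u v → ¬? (w u ℕ.≟ w v)) (elements C)) Cs)
  family-indicator w []       = refl
  family-indicator w (C ∷ Cs) = trans (cong₂ _*_ (distinct-indicator w (elements C)) (family-indicator w Cs))
    (sym (if-∧ (does (allPairs? (λ u v → ¬? (w u ℕ.≟ w v)) (elements C)))
               (does (all? (λ C → allPairs? (λ u v → ¬? (w u ℕ.≟ w v)) (elements C)) Cs))))

unique-++⁻ʳ : ∀ {X : Set} (xs : List X) {ys} → Unique (xs ++ ys) → Unique ys
unique-++⁻ʳ []       u       = u
unique-++⁻ʳ (x ∷ xs) (_ ∷ u) = unique-++⁻ʳ xs u

unique-++⁻ˡ : ∀ {X : Set} (xs : List X) {ys} → Unique (xs ++ ys) → Unique xs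
unique-++⁻ˡ []       u       = []
unique-++⁻ˡ (x ∷ xs) (p ∷ u) = All.++⁻ˡ xs p ∷ unique-++⁻ˡ xs u

unique-disjoint : ∀ {X : Set} (xs : List X) {ys x} → Unique (xs ++ ys) → x ∈ xs → x ∉ ys
unique-disjoint (x ∷ xs) (p ∷ u) (here refl) x∈ys = All.lookup (All.++⁻ʳ xs p) x∈ys refl
unique-disjoint (x ∷ xs) (p ∷ u) (there x∈xs) x∈ys = unique-disjoint xs u x∈xs x∈ys

unique-sets-↭ : ∀ {X : Set} {xs ys : List X} → Unique xs → Unique ys → (∀ {x} → x ∈ xs → x ∈ ys) →
                (∀ {x} → x ∈ ys → x ∈ xs) → xs ↭ ys
unique-sets-↭ u v f g = ∼bag⇒↭ (unique∧set⇒bag u v (mk⇔ f g))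

allPairs-lookup : ∀ {X : Set} {R : X → X → Set} {xs x y} → (∀ {x y} → R x y → R y x) →
                  AllPairs R xs → x ∈ xs → y ∈ xs → x ≢ y → R x y
allPairs-lookup R-sym (p ∷ ps) (here refl) (here refl) x≢y = contradiction refl x≢y
allPairs-lookup R-sym (p ∷ ps) (here refl) (there y∈)  x≢y = All.lookup p y∈
allPairs-lookup R-sym (p ∷ ps) (there x∈)  (here refl) x≢y = R-sym (All.lookup p x∈)
allPairs-lookup R-sym (p ∷ ps) (there x∈)  (there y∈)  x≢y = allPairs-lookup R-sym ps x∈ y∈ x≢y

allPairs-tabulate : ∀ {X : Set} {R : X → X → Set} {xs} → Unique xs →
                    (∀ {x y} → x ∈ xs → y ∈ xs → x ≢ y → R x y) → AllPairs R xs
allPairs-tabulate []       r = []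
allPairs-tabulate (p ∷ ps) r =
  All.tabulate (λ y∈ → r (here refl) (there y∈) (All.lookup p y∈))
  ∷ allPairs-tabulate ps (λ x∈ y∈ → r (there x∈) (there y∈))

open Sort (Flip.decTotalOrder ℕ.≤-decTotalOrder) using (sort; sort-↭; sort-↗)

sort-cong-↭ : ∀ {ms ns} → ms ↭ ns → sort ms ≡ sort ns
sort-cong-↭ {ms} {ns} p = Pointwise-≡⇒≡
  (↗↭↗⇒≋ (DecTotalOrder.totalOrder (Flip.decTotalOrder ℕ.≤-decTotalOrder)) (sort-↗ ms) (sort-↗ ns)
    (↭⇒↭ₛ (↭-trans (sort-↭ ms) (↭-trans p (↭-sym (sort-↭ ns))))))

blockOf-surjective : ∀ {d k} (π : Partition d k) b → ∃ λ i → blockOf π i ≡ b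
blockOf-surjective (singleton π) zero    = zero , refl
blockOf-surjective (singleton π) (suc b) with i , eq ← blockOf-surjective π b = suc i , cong suc eq
blockOf-surjective (join c π)    b       with i , eq ← blockOf-surjective π b = suc i , eq

kernel : ∀ {d} (ℓ : Fin d → ℕ) → ∃ λ (σ : SetPartition d) → ∀ i j → SameBlock σ i j ⇔ ℓ i ≡ ℓ j
kernel {zero}  ℓ = (0 , []) , λ ()
kernel {suc d} ℓ with kernel (ℓ ∘ suc) | Fin.any? (λ i → ℓ zero ℕ.≟ ℓ (suc i))
... | (k , π) , same | yes (i , ℓ₀≡ℓᵢ) = (k , join (blockOf π i) π) , same′
  where
  same′ : ∀ a b → SameBlock (k , join (blockOf π i) π) a b ⇔ ℓ a ≡ ℓ b
  same′ zero    zero    = mk⇔ (λ _ → refl) (λ _ → refl)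
  same′ zero    (suc b) = mk⇔ (λ eq → trans ℓ₀≡ℓᵢ (Equivalence.to (same i b) eq))
                              (λ eq → Equivalence.from (same i b) (trans (sym ℓ₀≡ℓᵢ) eq))
  same′ (suc a) zero    = mk⇔ (λ eq → trans (Equivalence.to (same a i) eq) (sym ℓ₀≡ℓᵢ))
                              (λ eq → Equivalence.from (same a i) (trans eq ℓ₀≡ℓᵢ))
  same′ (suc a) (suc b) = same a b
... | (k , π) , same | no ¬any = (suc k , singleton π) , same′
  where
  same′ : ∀ a b → SameBlock (suc k , singleton π) a b ⇔ ℓ a ≡ ℓ b
  same′ zero    zero    = mk⇔ (λ _ → refl) (λ _ → refl)
  same′ zero    (suc b) = mk⇔ (λ ()) (λ eq → contradiction (b , eq) ¬any)
  same′ (suc a) zero    = mk⇔ (λ ()) (λ eq → contradiction (a , sym eq) ¬any)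
  same′ (suc a) (suc b) = mk⇔ (λ eq → Equivalence.to (same a b) (Fin.suc-injective eq))
                              (λ eq → cong suc (Equivalence.from (same a b) eq))

module _ {d : ℕ} where

  open import Data.List.Membership.DecPropositional (Fin._≟_ {d}) using (_∈?_)

  -- An element outside all blocks gets the length of the list as label, which no block uses.
  label : List (Block (Fin d)) → Fin d → ℕ
  label []       i = 0
  label (C ∷ Cs) i = if does (i ∈? elements C) then 0 else suc (label Cs i)

  label-∈ : ∀ C Cs {i} → i ∈ elements C → label (C ∷ Cs) i ≡ 0
  label-∈ C Cs {i} i∈C = cong (if_then 0 else suc (label Cs i)) (does-≡ (i ∈? elements C) (yes i∈C))

  label-∉ : ∀ C Cs {i} → i ∉ elements C → label (C ∷ Cs) i ≡ suc (label Cs i)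
  label-∉ C Cs {i} i∉C = cong (if_then 0 else suc (label Cs i)) (does-≡ (i ∈? elements C) (no i∉C))

  ∈-support : ∀ {Bs C} {i : Fin d} → C ∈ Bs → i ∈ elements C → i ∈ support Bs
  ∈-support C∈Bs i∈C = ∈-concatMap⁺ elements (lose C∈Bs i∈C)

  same-label⇔∈ : ∀ {Bs C u i} → Unique (support Bs) → C ∈ Bs → u ∈ elements C →
                 label Bs i ≡ label Bs u ⇔ i ∈ elements C
  same-label⇔∈ {C ∷ Cs} {u = u} {i} uniq (here refl) u∈C = mk⇔ to (λ i∈C → trans (label-∈ C Cs i∈C) (sym (label-∈ C Cs u∈C)))
    where
    to : label (C ∷ Cs) i ≡ label (C ∷ Cs) u → i ∈ elements C
    to eq with i ∈? elements C
    ... | yes i∈C = i∈C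
    ... | no i∉C with () ← trans (sym (label-∉ C Cs i∉C)) (trans eq (label-∈ C Cs u∈C))
  same-label⇔∈ {C ∷ Cs} {D} {u} {i} uniq (there D∈Cs) u∈D = mk⇔ to from
    where
    u∉C : u ∉ elements C
    u∉C u∈C = unique-disjoint (elements C) uniq u∈C (∈-support D∈Cs u∈D)
    rec = same-label⇔∈ {i = i} (unique-++⁻ʳ (elements C) uniq) D∈Cs u∈D
    to : label (C ∷ Cs) i ≡ label (C ∷ Cs) u → i ∈ elements D
    to eq with i ∈? elements C
    ... | yes i∈C with () ← trans (sym (label-∈ C Cs i∈C)) (trans eq (label-∉ C Cs u∉C))
    ... | no i∉C  = Equivalence.to rec
      (ℕ.suc-injective (trans (sym (label-∉ C Cs i∉C)) (trans eq (label-∉ C Cs u∉C))))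
    from : i ∈ elements D → label (C ∷ Cs) i ≡ label (C ∷ Cs) u
    from i∈D = trans (label-∉ C Cs λ i∈C → unique-disjoint (elements C) uniq i∈C (∈-support D∈Cs i∈D))
      (trans (cong suc (Equivalence.from rec i∈D)) (sym (label-∉ C Cs u∉C)))

  unique-block : ∀ {C : Block (Fin d)} {Bs} → Unique (support Bs) → C ∈ Bs → Unique (elements C)
  unique-block {C} uniq (here refl) = unique-++⁻ˡ (elements C) uniq
  unique-block {Bs = D ∷ _} uniq (there C∈Bs) = unique-block (unique-++⁻ʳ (elements D) uniq) C∈Bs

  module FromBlocks (Bs : List (Block (Fin d))) (cover : support Bs ↭ allFin d) where

    partition : SetPartition d
    partition = proj₁ (kernel (label Bs))

    π = proj₂ partition

    uniq : Unique (support Bs)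
    uniq = Unique-resp-↭ (setoid (Fin d)) (↭⇒↭ₛ (↭-sym cover)) (Unique.allFin⁺ d)

    block-of : ∀ i → ∃ λ C → C ∈ Bs × i ∈ elements C
    block-of i = find (∈-concatMap⁻ elements (∈-resp-↭ (↭-sym cover) (∈-allFin i)))

    same-block⇔∈ : ∀ {C u i} → C ∈ Bs → u ∈ elements C → blockOf π i ≡ blockOf π u ⇔ i ∈ elements C
    same-block⇔∈ {i = i} C∈Bs u∈C = mk⇔
      (λ eq → Equivalence.to (same-label⇔∈ uniq C∈Bs u∈C) (Equivalence.to (proj₂ (kernel (label Bs)) _ _) eq))
      (λ i∈C → Equivalence.from (proj₂ (kernel (label Bs)) _ _) (Equivalence.from (same-label⇔∈ uniq C∈Bs u∈C) i∈C))

    blockSize-≡ : ∀ {C u} → C ∈ Bs → u ∈ elements C → blockSize π (blockOf π u) ≡ suc (size C)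
    blockSize-≡ {C} {u} C∈Bs u∈C = ↭-length (unique-sets-↭
      (Unique.filter⁺ (λ i → blockOf π i Fin.≟ blockOf π u) (Unique.allFin⁺ d)) (unique-block uniq C∈Bs)
      (λ i∈ → Equivalence.to (same-block⇔∈ C∈Bs u∈C)
        (proj₂ (∈-filter⁻ (λ i → blockOf π i Fin.≟ blockOf π u) {xs = allFin d} i∈)))
      (λ i∈C → ∈-filter⁺ (λ i → blockOf π i Fin.≟ blockOf π u) (∈-allFin _) (Equivalence.from (same-block⇔∈ C∈Bs u∈C) i∈C)))

    index : Block (Fin d) → Fin (proj₁ partition)
    index (u , _) = blockOf π u

    indices-unique : ∀ {Cs} → Unique (support Cs) → (∀ {C} → C ∈ Cs → C ∈ Bs) → Unique (map index Cs)
    indices-unique {[]}     _    _  = []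
    indices-unique {C ∷ Cs} uniq Cs⊆Bs =
      All.map⁺ (All.tabulate λ {D} D∈Cs eq →
        unique-disjoint (elements C) uniq
          (Equivalence.to (same-block⇔∈ (Cs⊆Bs (here refl)) (here refl)) (sym eq))
          (∈-support D∈Cs (here refl)))
      ∷ indices-unique (unique-++⁻ʳ (elements C) uniq) (Cs⊆Bs ∘ there)

    indices-↭ : map index Bs ↭ allFin (proj₁ partition)
    indices-↭ = unique-sets-↭ (indices-unique uniq (λ C∈Bs → C∈Bs)) (Unique.allFin⁺ _) (λ _ → ∈-allFin _) λ {b} _ → found b
      where
      found : ∀ b → b ∈ map index Bs
      found b with i , refl ← blockOf-surjective π b with C , C∈Bs , i∈C ← block-of i =
        subst (_∈ map index Bs) (sym (Equivalence.from (same-block⇔∈ C∈Bs (here refl)) i∈C)) (∈-map⁺ index C∈Bs)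

    type-≡ : type partition ≡ sort (map (suc ∘ size) Bs)
    type-≡ = sort-cong-↭ (↭-trans (map⁺ (blockSize π) (↭-sym indices-↭)) (↭-reflexive
      (trans (sym (map-∘ Bs)) (map-cong-local (All.tabulate λ {C} C∈Bs → blockSize-≡ {C} C∈Bs (here refl))))))

    family-≡ : ∀ w → family w Bs ≡ e partition w
    family-≡ w = trans (family-indicator w Bs)
      (indicator-cong (all? (λ C → allPairs? (λ u v → ¬? (w u ℕ.≟ w v)) (elements C)) Bs)
        (distinctOnBlocks? partition w) to from)
      where
      to : All (NoRepeats w) Bs → DistinctOnBlocks partition w
      to all j k j≢k same with C , C∈Bs , k∈C ← block-of k =
        allPairs-lookup (λ ≢ → ≢ ∘ sym) (All.lookup all C∈Bs) (Equivalence.to (same-block⇔∈ C∈Bs k∈C) same) k∈C j≢k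
      from : DistinctOnBlocks partition w → All (NoRepeats w) Bs
      from dist = All.tabulate λ {C} C∈Bs → allPairs-tabulate (unique-block uniq C∈Bs)
        λ j∈C k∈C j≢k → dist _ _ j≢k (Equivalence.from (same-block⇔∈ C∈Bs k∈C) j∈C)

-- Enumeration of set partitions

_≟ᴾ_ : ∀ {d k} → DecidableEquality (Partition d k)
[]          ≟ᴾ []          = yes refl
singleton π ≟ᴾ singleton σ = map′ (cong singleton) (λ { refl → refl }) (π ≟ᴾ σ)
singleton π ≟ᴾ join c σ    = no λ ()
join b π    ≟ᴾ singleton σ = no λ ()
join b π    ≟ᴾ join c σ    =
  map′ (λ { (refl , refl) → refl }) (λ { refl → refl , refl }) ((b Fin.≟ c) ×-dec (π ≟ᴾ σ))

_≟ˢ_ : ∀ {d} → DecidableEquality (SetPartition d)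
_≟ˢ_ = Product.≡-dec ℕ._≟_ _≟ᴾ_

extensions : ∀ {d} → SetPartition d → List (SetPartition (suc d))
extensions (k , π) = (suc k , singleton π) ∷ map (λ b → k , join b π) (allFin k)

setPartitions-suc : ∀ d → setPartitions (suc d) ≡ concatMap extensions (setPartitions d)
setPartitions-suc d = concatMap-cong (λ _ → refl) (setPartitions d)

∈-setPartitions : ∀ {d} (σ : SetPartition d) → σ ∈ setPartitions d
∈-setPartitions (_ , [])                        = here refl
∈-setPartitions {suc d} (suc k , singleton σ) = subst ((suc k , singleton σ) ∈_) (sym (setPartitions-suc d))
  (∈-concatMap⁺ extensions (lose (∈-setPartitions (k , σ)) (here refl)))
∈-setPartitions {suc d} (k , join b σ)        = subst ((k , join b σ) ∈_) (sym (setPartitions-suc d))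
  (∈-concatMap⁺ extensions (lose (∈-setPartitions (k , σ)) (there (∈-map⁺ (λ b → k , join b σ) (∈-allFin b)))))

restrict : ∀ {d} → SetPartition (suc d) → SetPartition d
restrict (_ , singleton π) = _ , π
restrict (_ , join b π)    = _ , π

restrict-extension : ∀ {d} {σ : SetPartition (suc d)} π → σ ∈ extensions π → restrict σ ≡ π
restrict-extension (k , π) (here refl) = refl
restrict-extension (k , π) (there σ∈) with b , _ , refl ← ∈-map⁻ (λ b → k , join b π) σ∈ = refl

extensions-unique : ∀ {d} (π : SetPartition d) → Unique (extensions π)
extensions-unique (k , π) =
  All.map⁺ (All.tabulate λ _ ()) ∷ Unique.map⁺ (λ { refl → refl }) (Unique.allFin⁺ k)

setPartitions-unique : ∀ d → Unique (setPartitions d)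
setPartitions-unique zero    = [] ∷ []
setPartitions-unique (suc d) = subst Unique (sym (setPartitions-suc d)) (Unique.concat⁺
  (All.map⁺ (All.universal extensions-unique (setPartitions d)))
  (AllPairs.map⁺ (AllPairs.map (λ {π} {σ} π≢σ {_} (∈₁ , ∈₂) →
    π≢σ (trans (sym (restrict-extension π ∈₁)) (restrict-extension σ ∈₂))) (setPartitions-unique d))))

∑-zero : ∀ {X : Set} {f : X → ℚ} {xs} → All (λ x → f x ≡ 0ℚ) xs → ∑ f xs ≡ 0ℚ
∑-zero []         = refl
∑-zero (eq ∷ eqs) = cong₂ _+_ eq (∑-zero eqs)

∑-indicator : ∀ {X : Set} (_≟_ : DecidableEquality X) (h : X → ℚ) {x xs} → Unique xs → x ∈ xs →
              ∑ (λ y → indicator (y ≟ x) * h y) xs ≡ h x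
∑-indicator _≟_ h {x} {_ ∷ xs} (x∉ ∷ u) (here refl) = begin
  indicator (x ≟ x) * h x + ∑ (λ y → indicator (y ≟ x) * h y) xs
    ≡⟨ cong₂ _+_ (cong (_* h x) (indicator-yes (x ≟ x) refl))
         (∑-zero (All.map (λ {y} x≢y → trans (cong (_* h y) (indicator-no (y ≟ x) (x≢y ∘ sym))) (ℚ.*-zeroˡ (h y))) x∉)) ⟩
  1ℚ * h x + 0ℚ
    ≡⟨ trans (ℚ.+-identityʳ (1ℚ * h x)) (ℚ.*-identityˡ (h x)) ⟩
  h x ∎
  where open ≡-Reasoning
∑-indicator _≟_ h {x} {y ∷ xs} (y∉ ∷ u) (there x∈xs) = begin
  indicator (y ≟ x) * h y + ∑ (λ y → indicator (y ≟ x) * h y) xs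
    ≡⟨ cong₂ _+_ (trans (cong (_* h y) (indicator-no (y ≟ x) (All.lookup y∉ x∈xs))) (ℚ.*-zeroˡ (h y)))
         (∑-indicator _≟_ h u x∈xs) ⟩
  0ℚ + h x
    ≡⟨ ℚ.+-identityˡ (h x) ⟩
  h x ∎
  where open ≡-Reasoning

∑-filter : ∀ {X : Set} {Q : X → Set} (Q? : Decidable Q) (f : X → ℚ) xs →
           ∑ f (filter Q? xs) ≡ ∑ (λ x → f x * indicator (Q? x)) xs
∑-filter Q? f []       = refl
∑-filter Q? f (x ∷ xs) with does (Q? x)
... | true  = cong₂ _+_ (sym (ℚ.*-identityʳ (f x))) (∑-filter Q? f xs)
... | false = trans (∑-filter Q? f xs) (trans (sym (ℚ.+-identityˡ _)) (cong (_+ _) (sym (ℚ.*-zeroʳ (f x)))))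

-- Class sums

recip-nonNeg : ∀ n → 0ℚ ≤ recip n
recip-nonNeg n = ℚ.<⇒≤ (ℚ.positive⁻¹ (recip n) {{ℚ.1/pos⇒pos (ι (suc n)) {{positive (ι-positive n)}}}})

recipFact : ℕ → ℚ
recipFact zero    = 1ℚ
recipFact (suc n) = recip n * recipFact n

recipFacts : List ℕ → ℚ
recipFacts []       = 1ℚ
recipFacts (l ∷ λs) = recipFact (suc l) * recipFacts λs

recipFact-inverse : ∀ n → fact n * recipFact n ≡ 1ℚ
recipFact-inverse zero    = refl
recipFact-inverse (suc n) = trans (regroup (ι (suc n)) (fact n) (recip n) (recipFact n))
  (cong₂ _*_ (recip-inverse n) (recipFact-inverse n))
  where
  regroup : ∀ a b c d → a * b * (c * d) ≡ c * a * (b * d)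
  regroup = solve-∀ ring

recipFacts-inverse : ∀ λs → facts λs * recipFacts λs ≡ 1ℚ
recipFacts-inverse []       = refl
recipFacts-inverse (l ∷ λs) = trans (regroup (fact (suc l)) (facts λs) (recipFact (suc l)) (recipFacts λs))
  (cong₂ _*_ (recipFact-inverse (suc l)) (recipFacts-inverse λs))
  where
  regroup : ∀ a b c d → a * b * (c * d) ≡ a * c * (b * d)
  regroup = solve-∀ ring

recipFact-nonNeg : ∀ n → 0ℚ ≤ recipFact n
recipFact-nonNeg zero    = 0≤1
recipFact-nonNeg (suc n) = *-nonNeg (recip-nonNeg n) (recipFact-nonNeg n)

recipFacts-nonNeg : ∀ λs → 0ℚ ≤ recipFacts λs
recipFacts-nonNeg []       = 0≤1
recipFacts-nonNeg (l ∷ λs) = *-nonNeg (recipFact-nonNeg (suc l)) (recipFacts-nonNeg λs)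

recipFacts-↭ : ∀ {λs μs} → λs ↭ μs → recipFacts λs ≡ recipFacts μs
recipFacts-↭ ↭.refl                      = refl
recipFacts-↭ (↭.prep l p)                = cong (recipFact (suc l) *_) (recipFacts-↭ p)
recipFacts-↭ (↭.swap {xs = λs} l m p)    =
  trans (swap-factors (recipFact (suc l)) (recipFact (suc m)) (recipFacts λs))
    (cong (λ r → recipFact (suc m) * (recipFact (suc l) * r)) (recipFacts-↭ p))
recipFacts-↭ (↭.trans p q)               = trans (recipFacts-↭ p) (recipFacts-↭ q)

indicator-nonNeg : ∀ {X : Set} (x? : Dec X) → 0ℚ ≤ indicator x?
indicator-nonNeg x? with does x?
... | true  = 0≤1
... | false = ℚ.≤-refl

module _ {n : ℕ} (π : SetPartition (suc n)) where

  HasSizes : ℕ → List ℕ → Set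
  HasSizes b λs = type π ≡ sort (map suc (b ∷ λs)) × lastBlockSize π ≡ suc b

  hasSizes? : ∀ b λs → Dec (HasSizes b λs)
  hasSizes? b λs = List.≡-dec ℕ._≟_ (type π) (sort (map suc (b ∷ λs))) ×-dec (lastBlockSize π ℕ.≟ suc b)

  -- The test weighting that reads off the class sum of `π`: the reciprocal factorials undo
  -- `weight`, so a single family contributes 1 or 0.
  classWeighting : Weighting
  classWeighting b λs = indicator (hasSizes? b λs) * (recipFact b * recipFacts λs)

  classWeighting-sym : Sym classWeighting
  classWeighting-sym b {λs} {μs} p = cong₂ _*_
    (indicator-cong (hasSizes? b λs) (hasSizes? b μs)
      (λ (t , l) → trans t (sort-cong-↭ (map⁺ suc (↭.prep b p))) , l)
      (λ (t , l) → trans t (sort-cong-↭ (map⁺ suc (↭.prep b (↭-sym p)))) , l))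
    (cong (recipFact b *_) (recipFacts-↭ p))

  classWeighting-nonNeg : NonNeg classWeighting
  classWeighting-nonNeg b λs =
    *-nonNeg (indicator-nonNeg (hasSizes? b λs)) (*-nonNeg (recipFact-nonNeg b) (recipFacts-nonNeg λs))

  weight-classWeighting : ∀ b λs → weight b λs * classWeighting b λs ≡ indicator (hasSizes? b λs)
  weight-classWeighting b λs =
    trans (regroup (fact b) (facts λs) (indicator (hasSizes? b λs)) (recipFact b) (recipFacts λs))
      (trans (cong₂ (λ p q → indicator (hasSizes? b λs) * (p * q)) (recipFact-inverse b) (recipFacts-inverse λs))
        (ℚ.*-identityʳ _))
    where
    regroup : ∀ f g i r s → f * g * (i * (r * s)) ≡ i * (f * r * (g * s))
    regroup = solve-∀ ring

-- For one family the coefficients are concentrated on its set partition, whose membership in a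
-- class is decided by the block sizes alone. The other cases follow by linearity.
coefficients : ∀ {n f Φ} → Expansion (fromℕ n) (allFin (suc n)) f Φ →
  ∃ λ (c : SetPartition (suc n) → ℚ) →
    (∀ w → f w ≡ eCombination c w) × (∀ π → classSum c π ≡ Φ (classWeighting π))
coefficients {n} (blocks B Cs p) = (λ τ → indicator (τ ≟ˢ σ)) , combination , sums-to
  where
  open FromBlocks ((fromℕ n , B) ∷ Cs) p renaming (partition to σ) hiding (π)
  combination : ∀ w → family w ((fromℕ n , B) ∷ Cs) ≡ eCombination (λ τ → indicator (τ ≟ˢ σ)) w
  combination w = trans (family-≡ w)
    (sym (∑-indicator _≟ˢ_ (λ τ → e τ w) (setPartitions-unique (suc n)) (∈-setPartitions σ)))
  type-σ : type σ ≡ sort (map suc (length B ∷ map size Cs))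
  type-σ = trans type-≡ (cong (λ l → sort (suc (length B) ∷ l)) (map-∘ Cs))
  last-σ : lastBlockSize σ ≡ suc (length B)
  last-σ = blockSize-≡ (here refl) (here refl)
  sums-to : ∀ π → classSum (λ τ → indicator (τ ≟ˢ σ)) π
                ≡ weight (length B) (map size Cs) * classWeighting π (length B) (map size Cs)
  sums-to π = begin
    ∑ (λ τ → indicator (τ ≟ˢ σ)) (filter (π ∼?_) (setPartitions (suc n)))
      ≡⟨ ∑-filter (π ∼?_) (λ τ → indicator (τ ≟ˢ σ)) (setPartitions (suc n)) ⟩
    ∑ (λ τ → indicator (τ ≟ˢ σ) * indicator (π ∼? τ)) (setPartitions (suc n))
      ≡⟨ ∑-indicator _≟ˢ_ (λ τ → indicator (π ∼? τ)) (setPartitions-unique (suc n)) (∈-setPartitions σ) ⟩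
    indicator (π ∼? σ)
      ≡⟨ indicator-cong (π ∼? σ) (hasSizes? π (length B) (map size Cs))
           (λ (t , l) → trans t type-σ , trans l last-σ)
           (λ (t , l) → trans t (sym type-σ) , trans l (sym last-σ)) ⟩
    indicator (hasSizes? π (length B) (map size Cs))
      ≡⟨ sym (weight-classWeighting π (length B) (map size Cs)) ⟩
    weight (length B) (map size Cs) * classWeighting π (length B) (map size Cs) ∎
    where open ≡-Reasoning
coefficients {n} none = (λ _ → 0ℚ)
  , (λ w → sym (∑-zero (All.universal (λ σ → ℚ.*-zeroˡ (e σ w)) (setPartitions (suc n)))))
  , (λ π → ∑-zero (All.universal (λ _ → refl) (filter (π ∼?_) (setPartitions (suc n)))))
coefficients {n} (plus E E′) with c , comb , sum ← coefficients E | c′ , comb′ , sum′ ← coefficients E′ =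
  (λ σ → c σ + c′ σ)
  , (λ w → trans (cong₂ _+_ (comb w) (comb′ w))
      (sym (trans (∑-cong (λ σ → ℚ.*-distribʳ-+ (e σ w) (c σ) (c′ σ)) (setPartitions (suc n)))
                  (∑-+ (λ σ → c σ * e σ w) (λ σ → c′ σ * e σ w) (setPartitions (suc n))))))
  , (λ π → trans (∑-+ c c′ (filter (π ∼?_) (setPartitions (suc n)))) (cong₂ _+_ (sum π) (sum′ π)))
coefficients {n} (scale a E) with c , comb , sum ← coefficients E =
  (λ σ → a * c σ)
  , (λ w → trans (cong (a *_) (comb w))
      (sym (trans (∑-cong (λ σ → ℚ.*-assoc a (c σ) (e σ w)) (setPartitions (suc n)))
                  (∑-* a (λ σ → c σ * e σ w) (setPartitions (suc n))))))
  , (λ π → trans (∑-* a c (filter (π ∼?_) (setPartitions (suc n)))) (cong (a *_) (sum π)))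
coefficients (transport f≗g Φ≗Ψ E) with c , comb , sum ← coefficients E =
  c , (λ w → trans (sym (f≗g w)) (comb w)) , (λ π → trans (sum π) (Φ≗Ψ (classWeighting π)))

expansion⇒EPositive : ∀ {n} (G : SimpleGraph (suc n)) {Φ} → Expansion (fromℕ n) (allFin (suc n)) (Y G) Φ →
                      (∀ ψ → Sym ψ → NonNeg ψ → 0ℚ ≤ Φ ψ) → EPositive G
expansion⇒EPositive G E Φ≥0 =
  let c , combination , sums = coefficients E in
  c , combination , λ π → subst (0ℚ ≤_) (sym (sums π))
    (Φ≥0 (classWeighting π) (classWeighting-sym π) (classWeighting-nonNeg π))

-- Proper colourings of the chorded cycle

path-indicator : ∀ as → path as ≡ indicator (linked? (λ a b → ¬? (a ℕ.≟ b)) as)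
path-indicator []           = refl
path-indicator (a ∷ [])     = refl
path-indicator (a ∷ b ∷ as) = trans (cong₂ _*_ (ne-indicator a b) (path-indicator (b ∷ as)))
  (sym (if-∧ (does (¬? (a ℕ.≟ b))) (does (linked? (λ a b → ¬? (a ℕ.≟ b)) (b ∷ as)))))

linked-tabulate⁺ : ∀ n (w : Fin (suc n) → ℕ) → (∀ i → w (inject₁ i) ≢ w (suc i)) → Linked _≢_ (tabulate w)
linked-tabulate⁺ zero    w ne = [-]
linked-tabulate⁺ (suc n) w ne = ne zero ∷ linked-tabulate⁺ n (w ∘ suc) (ne ∘ suc)

linked-tabulate⁻ : ∀ n (w : Fin (suc n) → ℕ) → Linked _≢_ (tabulate w) → ∀ i → w (inject₁ i) ≢ w (suc i)
linked-tabulate⁻ (suc n) w (ne ∷ nes) zero    = ne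
linked-tabulate⁻ (suc n) w (ne ∷ nes) (suc i) = linked-tabulate⁻ n (w ∘ suc) nes i

tabulate-∷ʳ : ∀ {X : Set} n (f : Fin (suc n) → X) → tabulate f ≡ tabulate (f ∘ inject₁) ++ f (fromℕ n) ∷ []
tabulate-∷ʳ zero    f = refl
tabulate-∷ʳ (suc n) f = cong (f zero ∷_) (tabulate-∷ʳ n (f ∘ suc))

module ChordedCycle (k : ℕ) where

  m : ℕ
  m = suc (suc k)

  x d : Fin (suc (suc m))
  x = inject₁ (fromℕ m)
  d = fromℕ (suc m)

  middle : List (Fin (suc (suc m)))
  middle = tabulate {n = k} (λ i → suc (suc (inject₁ (inject₁ i))))

  vertices : zero ∷ suc zero ∷ middle ++ x ∷ d ∷ [] ≡ allFin (suc (suc m))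
  vertices = cong (λ l → zero ∷ suc zero ∷ l) (sym
    (trans (tabulate-∷ʳ (suc k) (λ i → suc (suc i)))
      (trans (cong (_++ d ∷ []) (tabulate-∷ʳ k (λ i → suc (suc (inject₁ i)))))
        (++-assoc middle (x ∷ []) (d ∷ [])))))

  Proper⇔ : ∀ w →
    (Proper (chordedCycle m) w → (Linked _≢_ (tabulate w) × w zero ≢ w d) × w (suc zero) ≢ w x) ×
    ((Linked _≢_ (tabulate w) × w zero ≢ w d) × w (suc zero) ≢ w x → Proper (chordedCycle m) w)
  Proper⇔ w = to , from
    where
    Step : Fin (suc (suc m)) → Fin (suc (suc m)) → Set
    Step i j = suc (toℕ i) ≡ toℕ j ⊎ (i ≡ d × j ≡ zero)
    to : Proper (chordedCycle m) w → (Linked _≢_ (tabulate w) × w zero ≢ w d) × w (suc zero) ≢ w x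
    to proper = (linked-tabulate⁺ (suc m) w consecutive , closing) , chord
      where
      consecutive : ∀ i → w (inject₁ i) ≢ w (suc i)
      consecutive i = proper (inject₁ i) (suc i)
        (i≢j , inj₁ (inj₁ (i≢j , inj₁ (inj₁ (cong suc (Fin.toℕ-inject₁ i))))))
        where
        i≢j : inject₁ i ≢ suc i
        i≢j eq = ℕ.1+n≢n (trans (cong toℕ (sym eq)) (Fin.toℕ-inject₁ i))
      closing : w zero ≢ w d
      closing = proper zero d ((λ ()) , inj₁ (inj₁ ((λ ()) , inj₂ (inj₂ (refl , refl)))))
      chord : w (suc zero) ≢ w x
      chord = proper (suc zero) x ((λ ()) , inj₁ (inj₂ (refl , refl)))
    from : (Linked _≢_ (tabulate w) × w zero ≢ w d) × w (suc zero) ≢ w x → Proper (chordedCycle m) w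
    -- `cycle` and `addEdge` each symmetrise their relation, so a cycle edge carries two
    -- orientations; reversing both restores the original direction.
    from ((linked , closing) , chord) i j = λ where
        (_ , inj₁ (inj₁ (_ , inj₁ s)))      → step s
        (_ , inj₁ (inj₁ (_ , inj₂ s)))      → step s ∘ sym
        (_ , inj₁ (inj₂ (refl , refl)))     → chord
        (_ , inj₂ (inj₁ (_ , inj₁ s)))      → step s ∘ sym
        (_ , inj₂ (inj₁ (_ , inj₂ s)))      → step s
        (_ , inj₂ (inj₂ (refl , refl)))     → chord ∘ sym
      where
      step : ∀ {i j} → Step i j → w i ≢ w j
      step {i} {suc j} (inj₁ eq) = subst (λ i → w i ≢ w (suc j))
        (Fin.toℕ-injective (trans (Fin.toℕ-inject₁ j) (sym (ℕ.suc-injective eq)))) (linked-tabulate⁻ (suc m) w linked j)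
      step (inj₂ (refl , refl)) = closing ∘ sym

  Y-product : ∀ w → path (w zero ∷ map w (suc zero ∷ middle) ++ w x ∷ w d ∷ []) * ne (w zero) (w d) * ne (w (suc zero)) (w x)
                    ≡ Y (chordedCycle m) w
  Y-product w = begin
    path (w zero ∷ map w (suc zero ∷ middle) ++ w x ∷ w d ∷ []) * ne (w zero) (w d) * ne (w (suc zero)) (w x)
      ≡⟨ cong (λ as → path as * ne (w zero) (w d) * ne (w (suc zero)) (w x)) colours ⟩
    path (tabulate w) * ne (w zero) (w d) * ne (w (suc zero)) (w x)
      ≡⟨ cong₂ _*_ (cong₂ _*_ (path-indicator (tabulate w)) (ne-indicator (w zero) (w d)))
                   (ne-indicator (w (suc zero)) (w x)) ⟩
    indicator linked * indicator closing * indicator chord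
      ≡⟨ cong (_* indicator chord) (sym (if-∧ (does linked) (does closing))) ⟩
    indicator (linked ×-dec closing) * indicator chord
      ≡⟨ sym (if-∧ (does (linked ×-dec closing)) (does chord)) ⟩
    indicator ((linked ×-dec closing) ×-dec chord)
      ≡⟨ indicator-cong ((linked ×-dec closing) ×-dec chord) (proper? (chordedCycle m) w)
           (proj₂ (Proper⇔ w)) (proj₁ (Proper⇔ w)) ⟩
    Y (chordedCycle m) w ∎
    where
    open ≡-Reasoning
    linked = linked? (λ a b → ¬? (a ℕ.≟ b)) (tabulate w)
    closing = ¬? (w zero ℕ.≟ w d)
    chord = ¬? (w (suc zero) ℕ.≟ w x)
    colours : w zero ∷ map w (suc zero ∷ middle) ++ w x ∷ w d ∷ [] ≡ tabulate w
    colours = trans (sym (map-++ w (zero ∷ suc zero ∷ middle) (x ∷ d ∷ [])))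
      (trans (cong (map w) vertices) (map-tabulate id w))

  Y-expansion : Expansion d (allFin (suc (suc m))) (Y (chordedCycle m))
      (λ ψ → F (suc (length middle)) (A (P ψ)) - F (suc (length middle)) (U (A ψ))
             + U (A^ (suc (length middle)) (U ψ)) 0 [] - F (length middle) (U (U (U ψ))))
  Y-expansion = transport Y-product (λ _ → refl)
    (Expansion-↭ (↭-reflexive vertices) (chordedCycle-expansion zero (suc zero) middle x d))

theorem4p3 : (m : ℕ) → m ≥ 3 → EPositive (chordedCycle m)
theorem4p3 (suc zero)    (s≤s ())
theorem4p3 (suc (suc k)) _ = expansion⇒EPositive (chordedCycle m) Y-expansion λ ψ ψ-sym ψ≥0 →
  -- `middle` with v_2 and v_{m+1} forms the cycle of length `m`; since `Z n` stands for a long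
  -- cycle on n + 1 vertices, the index is `suc (length middle)`.
  subst (0ℚ ≤_) (sym (chordedCycle-functional (length middle) ψ-sym)) (Z-nonNeg (suc (length middle)) ψ-sym ψ≥0)
  where open ChordedCycle k
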